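{- Let $q$ and $z$ be complex numbers with $|q|<1$. For any positive integers $k$ and $\ell$, we have $$ (-zq;q)_{\infty} = 1 + \sum_{m=1}^{\infty} \sum_{i=0}^{\ell-1} \frac{(-zq;q)_{km}}{(q;q)_{\ell m-i}}\, z^{\ell m-i}\, q^{(\ell m-i)((2k+\ell)m-i+1)/2} + \sum_{m=1}^{\infty} \sum_{j=0}^{k-1} \frac{(-zq;q)_{km-j-1}}{(q;q)_{\ell m-\ell}}\, z^{\ell m-\ell+1}\, q^{(\ell m-\ell+1)((2k+\ell)m-2j-\ell)/2}. $$
   Context: For complex $a$, $q$ and an integer $n\ge 0$, $(a;q)_n=\prod_{i=0}^{n-1}(1-aq^i)$ (so $(a;q)_0=1$), and for $|q|<1$, $(a;q)_\infty=\lim_{n\to\infty}(a;q)_n$. All exponents of $q$ appearing in the claim are nonnegative integers. -}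

module Defs where

open import Algebra.Bundles using (RawRing)
import Algebra.Definitions.RawSemiring as RawSemiringDefinitions
open import Data.Bool.Base using (true; false; if_then_else_)
open import Data.Fin.Base as Fin using (Fin; toℕ)
open import Data.Integer.Base as ℤ using (-[1+_])
import Data.Integer.Properties as ℤ
open import Data.Nat.Base as ℕ using (ℕ; zero; suc)
import Data.Nat.Properties as ℕ
open import Data.Product.Base using (∃; _×_; _,_; proj₁; proj₂)
open import Data.Rational.Base as ℚ using (ℚ; mkℚ; 0ℚ; 1ℚ; ½; _+_; _*_; _-_; -_; _≤_; _<_; _⊔_; 1/_; toℚᵘ) renaming (∣_∣ to ∣_∣ᑫ)
open import Data.Rational.Properties as ℚ using (≤-refl; ≤-trans; ≤-reflexive; <⇒≤; _≤?_)
open import Data.Rational.Solver using (module +-*-Solver)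
open import Data.Rational.Unnormalised.Base as ℚᵘ using (mkℚᵘ)
import Data.Rational.Unnormalised.Properties as ℚᵘ
open import Data.Sum.Base using (inj₁; inj₂)
open import Level using (0ℓ)
open import Relation.Binary.PropositionalEquality using (_≡_; refl; sym; trans; cong; cong₂; subst; subst₂)
open import Relation.Nullary using (Dec; does; yes; no)
open import Relation.Nullary.Negation using (contradiction)

open +-*-Solver using (solve; con; _:+_; _:*_; _:-_; :-_; _:=_)

------------------------------------------------------------------------
-- Rational arithmetic

abstract

  0<1 : 0ℚ < 1ℚ
  0<1 = ℚ.positive⁻¹ 1ℚ

  *-pos : ∀ {p r} → 0ℚ < p → 0ℚ < r → 0ℚ < p * r
  *-pos {p} {r} 0<p 0<r =
    ℚ.positive⁻¹ (p * r) {{ℚ.pos*pos⇒pos p {{ℚ.positive 0<p}} r {{ℚ.positive 0<r}}}}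

  *-nonNeg : ∀ {p r} → 0ℚ ≤ p → 0ℚ ≤ r → 0ℚ ≤ p * r
  *-nonNeg {p} {r} 0≤p 0≤r =
    ℚ.nonNegative⁻¹ (p * r)
      {{ℚ.nonNeg*nonNeg⇒nonNeg p {{ℚ.nonNegative 0≤p}} r {{ℚ.nonNegative 0≤r}}}}

  *-mono : ∀ {p r s t} → 0ℚ ≤ p → 0ℚ ≤ t → p ≤ r → s ≤ t → p * s ≤ r * t
  *-mono {p} {r} {s} {t} 0≤p 0≤t p≤r s≤t = ≤-trans
    (ℚ.*-monoˡ-≤-nonNeg p {{ℚ.nonNegative 0≤p}} s≤t)
    (ℚ.*-monoʳ-≤-nonNeg t {{ℚ.nonNegative 0≤t}} p≤r)

  +-nonNeg : ∀ {p r} → 0ℚ ≤ p → 0ℚ ≤ r → 0ℚ ≤ p + r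
  +-nonNeg 0≤p 0≤r = ℚ.+-mono-≤ 0≤p 0≤r

  ≤-+-nonNeg : ∀ {p r} → 0ℚ ≤ r → p ≤ p + r
  ≤-+-nonNeg {p} {r} 0≤r =
    subst (_≤ p + r) (ℚ.+-identityʳ p) (ℚ.+-monoʳ-≤ p 0≤r)

  square-nonNeg : ∀ p → 0ℚ ≤ p * p
  square-nonNeg p with ℚ.≤-total 0ℚ p
  ... | inj₁ 0≤p = *-nonNeg 0≤p 0≤p
  ... | inj₂ p≤0 =
    subst (0ℚ ≤_) (solve 1 (λ p → (:- p) :* (:- p) := p :* p) refl p)
      (*-nonNeg (ℚ.neg-antimono-≤ p≤0) (ℚ.neg-antimono-≤ p≤0))

  half+half : ∀ p → ½ * p + ½ * p ≡ p
  half+half = solve 1 (λ p → con ½ :* p :+ con ½ :* p := p) refl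

  half-pos : ∀ {p} → 0ℚ < p → 0ℚ < ½ * p
  half-pos = *-pos (ℚ.positive⁻¹ ½)

  half-≤ : ∀ {p} → 0ℚ ≤ p → ½ * p ≤ p
  half-≤ {p} 0≤p = subst (½ * p ≤_) (half+half p)
    (≤-+-nonNeg (*-nonNeg (ℚ.nonNegative⁻¹ ½) 0≤p))

  split : ∀ {k ε} → 0ℚ < k → 0ℚ < ε → ∃ λ δ → 0ℚ < δ × k * δ ≡ ε
  split {k} {ε} 0<k 0<ε = k⁻¹ * ε , *-pos 0<k⁻¹ 0<ε ,
    trans (sym (ℚ.*-assoc k k⁻¹ ε))
      (trans (cong (_* ε) (ℚ.*-inverseʳ k {{ℚ.>-nonZero 0<k}})) (ℚ.*-identityˡ ε))
    where
    k⁻¹ : ℚ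
    k⁻¹ = (1/ k) {{ℚ.>-nonZero 0<k}}
    0<k⁻¹ : 0ℚ < k⁻¹
    0<k⁻¹ = ℚ.positive⁻¹ k⁻¹ {{ℚ.1/pos⇒pos k {{ℚ.positive 0<k}}}}

  square-cancel-≤ : ∀ {p r} → 0ℚ ≤ r → p * p ≤ r * r → p ≤ r
  square-cancel-≤ {p} {r} 0≤r p²≤r² = ℚ.≮⇒≥ λ r<p →
    ℚ.<-irrefl refl (ℚ.<-≤-trans
      (ℚ.≤-<-trans (*-mono 0≤r (≤-trans 0≤r (<⇒≤ r<p)) ≤-refl (<⇒≤ r<p))
        (ℚ.*-monoˡ-<-pos p {{ℚ.positive (ℚ.≤-<-trans 0≤r r<p)}} r<p))
      p²≤r²)

  square-cancel-< : ∀ {p r} → 0ℚ ≤ r → p * p < r * r → p < r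
  square-cancel-< 0≤r p²<r² = ℚ.≰⇒> λ r≤p →
    ℚ.<-irrefl refl (ℚ.<-≤-trans p²<r² (*-mono 0≤r (≤-trans 0≤r r≤p) r≤p r≤p))

  ∣-∣-sym : ∀ p r → ∣ p - r ∣ᑫ ≡ ∣ r - p ∣ᑫ
  ∣-∣-sym p r = trans (sym (ℚ.∣-p∣≡∣p∣ (p - r)))
    (cong ∣_∣ᑫ (solve 2 (λ p r → :- (p :- r) := r :- p) refl p r))

  ∣-∣-triangle : ∀ p r s → ∣ p - s ∣ᑫ ≤ ∣ p - r ∣ᑫ + ∣ r - s ∣ᑫ
  ∣-∣-triangle p r s = subst (λ d → ∣ d ∣ᑫ ≤ ∣ p - r ∣ᑫ + ∣ r - s ∣ᑫ)
    (solve 3 (λ p r s → (p :- r) :+ (r :- s) := p :- s) refl p r s)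
    (ℚ.∣p+q∣≤∣p∣+∣q∣ (p - r) (r - s))

  ≤-∣-∣ : ∀ p → p ≤ ∣ p ∣ᑫ
  ≤-∣-∣ p with ℚ.≤-total 0ℚ p
  ... | inj₁ 0≤p = ≤-reflexive (sym (ℚ.0≤p⇒∣p∣≡p 0≤p))
  ... | inj₂ p≤0 = ≤-trans p≤0 (ℚ.0≤∣p∣ p)

  ∣-∣-+-≤ : ∀ p r s t → ∣ (p + r) - (s + t) ∣ᑫ ≤ ∣ p - s ∣ᑫ + ∣ r - t ∣ᑫ
  ∣-∣-+-≤ p r s t = subst (λ d → ∣ d ∣ᑫ ≤ ∣ p - s ∣ᑫ + ∣ r - t ∣ᑫ)
    (solve 4 (λ p r s t → (p :- s) :+ (r :- t) := (p :+ r) :- (s :+ t)) refl p r s t)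
    (ℚ.∣p+q∣≤∣p∣+∣q∣ (p - s) (r - t))

  ∣-∣-*-≤ : ∀ p r s t →
            ∣ p * r - s * t ∣ᑫ ≤ ∣ p ∣ᑫ * ∣ r - t ∣ᑫ + ∣ t ∣ᑫ * ∣ p - s ∣ᑫ
  ∣-∣-*-≤ p r s t = subst₂ _≤_
    (cong ∣_∣ᑫ (solve 4 (λ p r s t → p :* (r :- t) :+ t :* (p :- s) := p :* r :- s :* t)
      refl p r s t))
    (cong₂ _+_ (ℚ.∣p*q∣≡∣p∣*∣q∣ p (r - t)) (ℚ.∣p*q∣≡∣p∣*∣q∣ t (p - s)))
    (ℚ.∣p+q∣≤∣p∣+∣q∣ (p * (r - t)) (t * (p - s)))

  scaled-< : ∀ {a k d δ c} → 0ℚ ≤ d → 0ℚ < k → a ≤ k → d < δ → k * δ ≡ c → a * d < c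
  scaled-< {a} {k} {d} {δ} {c} 0≤d 0<k a≤k d<δ kδ≡c = subst (a * d <_) kδ≡c
    (ℚ.≤-<-trans (ℚ.*-monoʳ-≤-nonNeg d {{ℚ.nonNegative 0≤d}} a≤k)
      (ℚ.*-monoʳ-<-pos k {{ℚ.positive 0<k}} d<δ))

  *-close : ∀ p r s t {K L δ η ε} → 0ℚ < K → 0ℚ < L → K * δ ≡ ½ * ε → L * η ≡ ½ * ε →
            ∣ p ∣ᑫ ≤ K → ∣ t ∣ᑫ ≤ L → ∣ p - s ∣ᑫ < η → ∣ r - t ∣ᑫ < δ →
            ∣ p * r - s * t ∣ᑫ < ε
  *-close p r s t {K} {L} {δ} {η} {ε} 0<K 0<L Kδ≡½ε Lη≡½ε p≤K t≤L ps<η rt<δ =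
    ℚ.≤-<-trans (∣-∣-*-≤ p r s t)
      (subst (∣ p ∣ᑫ * ∣ r - t ∣ᑫ + ∣ t ∣ᑫ * ∣ p - s ∣ᑫ <_) (half+half ε)
        (ℚ.+-mono-< (scaled-< (ℚ.0≤∣p∣ (r - t)) 0<K p≤K rt<δ Kδ≡½ε)
                    (scaled-< (ℚ.0≤∣p∣ (p - s)) 0<L t≤L ps<η Lη≡½ε)))

  ∣-∣-square-≤ : ∀ {p r} → 0ℚ ≤ p → 0ℚ ≤ r →
                 ∣ p - r ∣ᑫ * ∣ p - r ∣ᑫ ≤ ∣ p * p - r * r ∣ᑫ
  ∣-∣-square-≤ {p} {r} 0≤p 0≤r = ≤-trans
    (ℚ.*-monoˡ-≤-nonNeg ∣ p - r ∣ᑫ {{ℚ.nonNegative (ℚ.0≤∣p∣ (p - r))}} ∣p-r∣≤∣p+r∣)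
    (≤-reflexive (trans (sym (ℚ.∣p*q∣≡∣p∣*∣q∣ (p - r) (p + r)))
      (cong ∣_∣ᑫ
        (solve 2 (λ p r → (p :- r) :* (p :+ r) := p :* p :- r :* r) refl p r))))
    where
    ∣p-r∣≤∣p+r∣ : ∣ p - r ∣ᑫ ≤ ∣ p + r ∣ᑫ
    ∣p-r∣≤∣p+r∣ = ≤-trans (ℚ.∣p-q∣≤∣p∣+∣q∣ p r) (≤-reflexive
      (trans (cong₂ _+_ (ℚ.0≤p⇒∣p∣≡p 0≤p) (ℚ.0≤p⇒∣p∣≡p 0≤r))
        (sym (ℚ.0≤p⇒∣p∣≡p (+-nonNeg 0≤p 0≤r)))))

  ∣p-0∣≤∣p-r∣ : ∀ {p r} → 0ℚ ≤ p → r ≤ 0ℚ → ∣ p - 0ℚ ∣ᑫ ≤ ∣ p - r ∣ᑫ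
  ∣p-0∣≤∣p-r∣ {p} {r} 0≤p r≤0 = subst (_≤ ∣ p - r ∣ᑫ)
    (sym (trans (cong ∣_∣ᑫ (ℚ.+-identityʳ p)) (ℚ.0≤p⇒∣p∣≡p 0≤p)))
    (≤-trans (≤-+-nonNeg (ℚ.neg-antimono-≤ r≤0)) (≤-∣-∣ (p - r)))

  ⊔-0-nonexpansive : ∀ p r → ∣ (p ⊔ 0ℚ) - (r ⊔ 0ℚ) ∣ᑫ ≤ ∣ p - r ∣ᑫ
  ⊔-0-nonexpansive p r with ℚ.≤-total 0ℚ p | ℚ.≤-total 0ℚ r
  ... | inj₁ 0≤p | inj₁ 0≤r =
    subst₂ (λ a b → ∣ a - b ∣ᑫ ≤ ∣ p - r ∣ᑫ)
      (sym (ℚ.p≥q⇒p⊔q≡p 0≤p)) (sym (ℚ.p≥q⇒p⊔q≡p 0≤r)) ≤-refl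
  ... | inj₁ 0≤p | inj₂ r≤0 =
    subst₂ (λ a b → ∣ a - b ∣ᑫ ≤ ∣ p - r ∣ᑫ)
      (sym (ℚ.p≥q⇒p⊔q≡p 0≤p)) (sym (ℚ.p≤q⇒p⊔q≡q r≤0))
      (∣p-0∣≤∣p-r∣ 0≤p r≤0)
  ... | inj₂ p≤0 | inj₁ 0≤r =
    subst₂ (λ a b → ∣ a - b ∣ᑫ ≤ ∣ p - r ∣ᑫ)
      (sym (ℚ.p≤q⇒p⊔q≡q p≤0)) (sym (ℚ.p≥q⇒p⊔q≡p 0≤r))
      (subst₂ _≤_ (∣-∣-sym r 0ℚ) (∣-∣-sym r p) (∣p-0∣≤∣p-r∣ 0≤r p≤0))
  ... | inj₂ p≤0 | inj₂ r≤0 =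
    subst₂ (λ a b → ∣ a - b ∣ᑫ ≤ ∣ p - r ∣ᑫ)
      (sym (ℚ.p≤q⇒p⊔q≡q p≤0)) (sym (ℚ.p≤q⇒p⊔q≡q r≤0)) (ℚ.0≤∣p∣ (p - r))

------------------------------------------------------------------------
-- Real numbers: Cauchy sequences of rationals up to null sequences

Cauchy : (ℕ → ℚ) → Set
Cauchy x = ∀ {ε} → 0ℚ < ε →
  ∃ λ N → ∀ {m n} → N ℕ.≤ m → N ℕ.≤ n → ∣ x m - x n ∣ᑫ < ε

record ℝ : Set where
  constructor mkℝ
  field
    seq    : ℕ → ℚ
    cauchy : Cauchy seq

open ℝ public

infix 4 _≈ʳ_ _<ʳ_

_≈ʳ_ : ℝ → ℝ → Set
x ≈ʳ y = ∀ {ε} → 0ℚ < ε → ∃ λ N → ∀ {n} → N ℕ.≤ n → ∣ seq x n - seq y n ∣ᑫ < ε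

-- Strict order carries an explicit rational gap, as a positive difference of
-- Cauchy sequences must not be allowed to tend to 0.
_<ʳ_ : ℝ → ℝ → Set
x <ʳ y = ∃ λ δ → 0ℚ < δ × ∃ λ N → ∀ {n} → N ℕ.≤ n → seq x n + δ ≤ seq y n

abstract

  const-cauchy : ∀ p → Cauchy (λ _ → p)
  const-cauchy p {ε} 0<ε = 0 , λ _ _ →
    subst (_< ε) (sym (cong ∣_∣ᑫ (ℚ.+-inverseʳ p))) 0<ε

  bounded : ∀ x → ∃ λ K → 0ℚ < K × ∃ λ N → ∀ {n} → N ℕ.≤ n → ∣ seq x n ∣ᑫ ≤ K
  bounded x =
    let N , close = cauchy x 0<1
        a = seq x N
    in ∣ a ∣ᑫ + 1ℚ
     , ℚ.<-≤-trans 0<1 (subst (1ℚ ≤_) (ℚ.+-comm 1ℚ ∣ a ∣ᑫ) (≤-+-nonNeg (ℚ.0≤∣p∣ a)))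
     , N , λ {n} N≤n → ≤-trans
         (subst (λ d → ∣ d ∣ᑫ ≤ ∣ a ∣ᑫ + ∣ seq x n - a ∣ᑫ)
           (solve 2 (λ p r → p :+ (r :- p) := r) refl a (seq x n))
           (ℚ.∣p+q∣≤∣p∣+∣q∣ a (seq x n - a)))
         (ℚ.+-monoʳ-≤ ∣ a ∣ᑫ (<⇒≤ (close N≤n ℕ.≤-refl)))

  +-cauchy : ∀ x y → Cauchy (λ n → seq x n + seq y n)
  +-cauchy x y {ε} 0<ε =
    let M , close-x = cauchy x (half-pos 0<ε)
        N , close-y = cauchy y (half-pos 0<ε)
    in M ℕ.⊔ N , λ {m} {n} ≤m ≤n →
      ℚ.≤-<-trans (∣-∣-+-≤ (seq x m) (seq y m) (seq x n) (seq y n))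
        (subst (∣ seq x m - seq x n ∣ᑫ + ∣ seq y m - seq y n ∣ᑫ <_) (half+half ε)
          (ℚ.+-mono-<
            (close-x (ℕ.m⊔n≤o⇒m≤o M N ≤m) (ℕ.m⊔n≤o⇒m≤o M N ≤n))
            (close-y (ℕ.m⊔n≤o⇒n≤o M N ≤m) (ℕ.m⊔n≤o⇒n≤o M N ≤n))))

  neg-cauchy : ∀ x → Cauchy (λ n → - seq x n)
  neg-cauchy x {ε} 0<ε =
    let N , close = cauchy x 0<ε
    in N , λ {m} {n} ≤m ≤n → subst (_< ε)
      (trans (∣-∣-sym (seq x m) (seq x n)) (cong ∣_∣ᑫ
        (solve 2 (λ p r → r :- p := (:- p) :- (:- r)) refl (seq x m) (seq x n))))
      (close ≤m ≤n)

  *-cauchy : ∀ x y → Cauchy (λ n → seq x n * seq y n)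
  *-cauchy x y {ε} 0<ε =
    let K , 0<K , M₁ , x≤K = bounded x
        L , 0<L , N₁ , y≤L = bounded y
        δ , 0<δ , Kδ≡½ε = split 0<K (half-pos 0<ε)
        η , 0<η , Lη≡½ε = split 0<L (half-pos 0<ε)
        M₂ , close-x = cauchy x 0<η
        N₂ , close-y = cauchy y 0<δ
        N₃ = M₁ ℕ.⊔ N₁
        N₄ = M₂ ℕ.⊔ N₂
    in N₃ ℕ.⊔ N₄ , λ {m} {n} ≤m ≤n →
      *-close (seq x m) (seq y m) (seq x n) (seq y n) 0<K 0<L Kδ≡½ε Lη≡½ε
        (x≤K (ℕ.m⊔n≤o⇒m≤o M₁ N₁ (ℕ.m⊔n≤o⇒m≤o N₃ N₄ ≤m)))
        (y≤L (ℕ.m⊔n≤o⇒n≤o M₁ N₁ (ℕ.m⊔n≤o⇒m≤o N₃ N₄ ≤n)))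
        (close-x (ℕ.m⊔n≤o⇒m≤o M₂ N₂ (ℕ.m⊔n≤o⇒n≤o N₃ N₄ ≤m))
                 (ℕ.m⊔n≤o⇒m≤o M₂ N₂ (ℕ.m⊔n≤o⇒n≤o N₃ N₄ ≤n)))
        (close-y (ℕ.m⊔n≤o⇒n≤o M₂ N₂ (ℕ.m⊔n≤o⇒n≤o N₃ N₄ ≤m))
                 (ℕ.m⊔n≤o⇒n≤o M₂ N₂ (ℕ.m⊔n≤o⇒n≤o N₃ N₄ ≤n)))

fromℚ : ℚ → ℝ
fromℚ p = mkℝ (λ _ → p) (const-cauchy p)

0ʳ 1ʳ : ℝ
0ʳ = fromℚ 0ℚ
1ʳ = fromℚ 1ℚ

infixl 6 _+ʳ_
infixl 7 _*ʳ_
infix  8 -ʳ_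

_+ʳ_ : ℝ → ℝ → ℝ
x +ʳ y = mkℝ (λ n → seq x n + seq y n) (+-cauchy x y)

-ʳ_ : ℝ → ℝ
-ʳ x = mkℝ (λ n → - seq x n) (neg-cauchy x)

_*ʳ_ : ℝ → ℝ → ℝ
x *ʳ y = mkℝ (λ n → seq x n * seq y n) (*-cauchy x y)

------------------------------------------------------------------------
-- Reciprocals of positive reals, termwise.  Only finitely many terms of the
-- sequence can vanish, and those are sent to 0.

recip : ℚ → ℚ
recip p with p ℚ.≟ 0ℚ
... | yes _   = 0ℚ
... | no  p≢0 = (1/ p) {{ℚ.≢-nonZero p≢0}}

abstract

  *-recip : ∀ {p} → 0ℚ < p → p * recip p ≡ 1ℚ
  *-recip {p} 0<p with p ℚ.≟ 0ℚ
  ... | yes p≡0 = contradiction (sym p≡0) (ℚ.<⇒≢ 0<p)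
  ... | no  p≢0 = ℚ.*-inverseʳ p {{ℚ.≢-nonZero p≢0}}

  recip-pos : ∀ {p} → 0ℚ < p → 0ℚ < recip p
  recip-pos {p} 0<p with p ℚ.≟ 0ℚ
  ... | yes p≡0 = contradiction (sym p≡0) (ℚ.<⇒≢ 0<p)
  ... | no  p≢0 = ℚ.positive⁻¹ _ {{ℚ.1/pos⇒pos p {{ℚ.positive 0<p}}}}

  recip-antimono : ∀ {p r} → 0ℚ < p → p ≤ r → recip r ≤ recip p
  recip-antimono {p} {r} 0<p p≤r = subst₂ _≤_
    (trans (cong (_* recip r) (trans (ℚ.*-comm (recip p) p) (*-recip 0<p)))
      (ℚ.*-identityˡ (recip r)))
    (trans (solve 3 (λ i r j → (i :* r) :* j := i :* (r :* j)) refl (recip p) r (recip r))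
      (trans (cong (recip p *_) (*-recip 0<r)) (ℚ.*-identityʳ (recip p))))
    (*-mono (*-nonNeg (<⇒≤ (recip-pos 0<p)) (<⇒≤ 0<p)) (<⇒≤ (recip-pos 0<r))
      (*-mono (<⇒≤ (recip-pos 0<p)) (<⇒≤ 0<r) ≤-refl p≤r) ≤-refl)
    where
    0<r : 0ℚ < r
    0<r = ℚ.<-≤-trans 0<p p≤r

  recip-difference : ∀ {p r} → 0ℚ < p → 0ℚ < r →
                     recip p - recip r ≡ (recip p * recip r) * (r - p)
  recip-difference {p} {r} 0<p 0<r = trans
    (cong₂ _-_ (trans (sym (ℚ.*-identityʳ (recip p))) (cong (recip p *_) (sym (*-recip 0<r))))
               (trans (sym (ℚ.*-identityʳ (recip r))) (cong (recip r *_) (sym (*-recip 0<p)))))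
    (solve 4 (λ i j p r → i :* (r :* j) :- j :* (p :* i) := (i :* j) :* (r :- p))
      refl (recip p) (recip r) p r)

  recip-close : ∀ {p r δ η ε} → 0ℚ < δ → (recip δ * recip δ) * η ≡ ε →
                δ ≤ p → δ ≤ r → ∣ r - p ∣ᑫ < η → ∣ recip p - recip r ∣ᑫ < ε
  recip-close {p} {r} {δ} {η} {ε} 0<δ D²η≡ε δ≤p δ≤r rp<η = subst (_< ε)
    (sym (trans (cong ∣_∣ᑫ (recip-difference 0<p 0<r))
      (trans (ℚ.∣p*q∣≡∣p∣*∣q∣ (recip p * recip r) (r - p))
        (cong (_* ∣ r - p ∣ᑫ)
          (ℚ.0≤p⇒∣p∣≡p (*-nonNeg (<⇒≤ (recip-pos 0<p)) (<⇒≤ (recip-pos 0<r))))))))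
    (scaled-< (ℚ.0≤∣p∣ (r - p)) (*-pos (recip-pos 0<δ) (recip-pos 0<δ))
      (*-mono (<⇒≤ (recip-pos 0<p)) (<⇒≤ (recip-pos 0<δ))
        (recip-antimono 0<δ δ≤p) (recip-antimono 0<δ δ≤r))
      rp<η D²η≡ε)
    where
    0<p : 0ℚ < p
    0<p = ℚ.<-≤-trans 0<δ δ≤p
    0<r : 0ℚ < r
    0<r = ℚ.<-≤-trans 0<δ δ≤r

  recip-cauchy : ∀ x → 0ʳ <ʳ x → Cauchy (λ n → recip (seq x n))
  recip-cauchy x (δ , 0<δ , M , δ≤x) 0<ε =
    let D²  = *-pos (recip-pos 0<δ) (recip-pos 0<δ)
        η , 0<η , D²η≡ε = split D² 0<ε
        N , close = cauchy x 0<η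
    in M ℕ.⊔ N , λ {m} {n} ≤m ≤n →
      recip-close 0<δ D²η≡ε
        (subst (_≤ seq x m) (ℚ.+-identityˡ δ) (δ≤x (ℕ.m⊔n≤o⇒m≤o M N ≤m)))
        (subst (_≤ seq x n) (ℚ.+-identityˡ δ) (δ≤x (ℕ.m⊔n≤o⇒m≤o M N ≤n)))
        (close (ℕ.m⊔n≤o⇒n≤o M N ≤n) (ℕ.m⊔n≤o⇒n≤o M N ≤m))

_⁻¹ʳ[_] : (x : ℝ) → 0ʳ <ʳ x → ℝ
x ⁻¹ʳ[ 0<x ] = mkℝ (λ n → recip (seq x n)) (recip-cauchy x 0<x)

------------------------------------------------------------------------
-- Square roots.  sqrtℚ p n is the left end of the n-th interval in the
-- bisection for √p that starts from [0, p + 1].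

2^-_ : ℕ → ℚ
2^- zero  = 1ℚ
2^- suc n = ½ * 2^- n

keepIf : ∀ {P : Set} → ℚ → ℚ → Dec P → ℚ
keepIf mid lo d = if does d then mid else lo

sqrtℚ : ℚ → ℕ → ℚ
sqrtℚ p zero    = 0ℚ
sqrtℚ p (suc n) = keepIf mid lo (mid * mid ≤? p)
  where
  lo  = sqrtℚ p n
  mid = lo + (p + 1ℚ) * 2^- suc n

abstract

  private

    ι : ℕ → ℚ
    ι zero    = 0ℚ
    ι (suc n) = 1ℚ + ι n

    toℚᵘ-ι : ∀ n → toℚᵘ (ι n) ℚᵘ.≃ mkℚᵘ (ℤ.+ n) 0
    toℚᵘ-ι zero    = ℚᵘ.≃-refl
    toℚᵘ-ι (suc n) = ℚᵘ.≃-trans (ℚ.toℚᵘ-homo-+ 1ℚ (ι n))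
      (ℚᵘ.≃-trans (ℚᵘ.+-congʳ (toℚᵘ 1ℚ) (toℚᵘ-ι n))
        (ℚᵘ.*≡* (cong (λ i → (ℤ.+ 1 ℤ.+ i) ℤ.* ℤ.+ 1) (ℤ.*-identityʳ (ℤ.+ n)))))

    archimedean : ∀ p → ∃ λ N → p ≤ ι N
    archimedean p@(mkℚ (ℤ.+ a) d _) = a , ℚ.toℚᵘ-cancel-≤
      (ℚᵘ.≤-respʳ-≃ (ℚᵘ.≃-sym (toℚᵘ-ι a))
        (ℚᵘ.*≤* (ℤ.*-monoˡ-≤-nonNeg (ℤ.+ a) (ℤ.+≤+ (ℕ.s≤s ℕ.z≤n)))))
    archimedean p@(mkℚ -[1+ _ ] _ _) = 0 , <⇒≤ (ℚ.negative⁻¹ p)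

    ι-nonNeg : ∀ n → 0ℚ ≤ ι n
    ι-nonNeg zero    = ≤-refl
    ι-nonNeg (suc n) = +-nonNeg (<⇒≤ 0<1) (ι-nonNeg n)

    ι-mono : ∀ {m n} → m ℕ.≤ n → ι m ≤ ι n
    ι-mono {n = n} ℕ.z≤n = ι-nonNeg n
    ι-mono (ℕ.s≤s m≤n)   = ℚ.+-monoʳ-≤ 1ℚ (ι-mono m≤n)

  2^-pos : ∀ n → 0ℚ < 2^- n
  2^-pos zero    = 0<1
  2^-pos (suc n) = half-pos (2^-pos n)

  2^-≤1 : ∀ n → 2^- n ≤ 1ℚ
  2^-≤1 zero    = ≤-refl
  2^-≤1 (suc n) = ≤-trans (half-≤ (<⇒≤ (2^-pos n))) (2^-≤1 n)

  private

    2^-*ι≤1 : ∀ n → 2^- n * ι n ≤ 1ℚ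
    2^-*ι≤1 zero    = <⇒≤ 0<1
    2^-*ι≤1 (suc n) = subst₂ _≤_
      (solve 2 (λ h i → con ½ :* h :+ con ½ :* (h :* i) := (con ½ :* h) :* (con 1ℚ :+ i))
        refl (2^- n) (ι n))
      (half+half 1ℚ)
      (ℚ.+-mono-≤ (ℚ.*-monoˡ-≤-nonNeg ½ (2^-≤1 n)) (ℚ.*-monoˡ-≤-nonNeg ½ (2^-*ι≤1 n)))

  2^-→0 : ∀ {ε} → 0ℚ < ε → ∃ λ N → ∀ {n} → N ℕ.≤ n → 2^- n < ε
  2^-→0 {ε} 0<ε =
    let δ , 0<δ , εδ≡1 = split 0<ε 0<1
        N , δ≤N = archimedean δ
    in suc N , λ {n} N<n → ℚ.*-cancelʳ-<-nonNeg δ {{ℚ.nonNegative (<⇒≤ 0<δ)}}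
      (subst (2^- n * δ <_) (sym εδ≡1)
        (ℚ.<-≤-trans
          (ℚ.*-monoʳ-<-pos (2^- n) {{ℚ.positive (2^-pos n)}}
            (ℚ.≤-<-trans δ≤N (ℚ.<-≤-trans
              (subst (_< 1ℚ + ι N) (ℚ.+-identityˡ (ι N)) (ℚ.+-monoˡ-< (ι N) 0<1))
              (ι-mono N<n))))
          (2^-*ι≤1 n)))

  Brackets : ℚ → ℚ → ℚ → Set
  Brackets p lo w = 0ℚ ≤ lo × lo * lo ≤ p × p ≤ (lo + w) * (lo + w)

  private

    bisect : ∀ {p lo w w′} → 0ℚ ≤ w′ → w′ + w′ ≡ w → Brackets p lo w →
             (d : Dec ((lo + w′) * (lo + w′) ≤ p)) → Brackets p (keepIf (lo + w′) lo d) w′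
    bisect {p} {lo} {w} {w′} 0≤w′ w′+w′≡w (0≤lo , _ , p≤) (yes mid²≤p) =
      +-nonNeg 0≤lo 0≤w′ , mid²≤p ,
      subst (λ hi → p ≤ hi * hi)
        (trans (cong (lo +_) (sym w′+w′≡w)) (sym (ℚ.+-assoc lo w′ w′))) p≤
    bisect _ _ (0≤lo , lo²≤p , _) (no mid²≰p) = 0≤lo , lo²≤p , <⇒≤ (ℚ.≰⇒> mid²≰p)

  sqrtℚ-brackets : ∀ {p} → 0ℚ ≤ p → ∀ n → Brackets p (sqrtℚ p n) ((p + 1ℚ) * 2^- n)
  sqrtℚ-brackets {p} 0≤p zero = ≤-refl , 0≤p ,
    subst (p ≤_)
      (solve 1 (λ p → p :+ (con 1ℚ :+ (p :+ p :* p)) :=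
                      (con 0ℚ :+ (p :+ con 1ℚ) :* con 1ℚ) :*
                      (con 0ℚ :+ (p :+ con 1ℚ) :* con 1ℚ)) refl p)
      (≤-+-nonNeg (+-nonNeg (<⇒≤ 0<1) (+-nonNeg 0≤p (square-nonNeg p))))
  sqrtℚ-brackets {p} 0≤p (suc n) = bisect
    (*-nonNeg (+-nonNeg 0≤p (<⇒≤ 0<1)) (<⇒≤ (2^-pos (suc n))))
    (solve 2 (λ p h → (p :+ con 1ℚ) :* (con ½ :* h) :+ (p :+ con 1ℚ) :* (con ½ :* h)
                      := (p :+ con 1ℚ) :* h) refl p (2^- n))
    (sqrtℚ-brackets 0≤p n)
    (mid * mid ≤? p)
    where
    mid : ℚ
    mid = sqrtℚ p n + (p + 1ℚ) * 2^- suc n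

  private

    sqrtℚ-gap : ∀ {p lo L h} → 0ℚ ≤ p → 0ℚ ≤ h → h ≤ 1ℚ → p + 1ℚ ≤ L →
                Brackets p lo ((p + 1ℚ) * h) →
                ∣ lo * lo - p ∣ᑫ ≤ (L * (L + L + L)) * h
    sqrtℚ-gap {p} {lo} {L} {h} 0≤p 0≤h h≤1 p+1≤L (0≤lo , lo²≤p , p≤) =
      subst (_≤ (L * (L + L + L)) * h) ∣-∣-eq
        (≤-trans p-lo²≤ (≤-trans w*≤ (≤-reflexive
          (solve 2 (λ L h → (L :* h) :* (L :+ L :+ L) := (L :* (L :+ L :+ L)) :* h)
            refl L h))))
      where
      w : ℚ
      w = (p + 1ℚ) * h
      0≤p+1 : 0ℚ ≤ p + 1ℚ
      0≤p+1 = +-nonNeg 0≤p (<⇒≤ 0<1)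
      0≤L : 0ℚ ≤ L
      0≤L = ≤-trans 0≤p+1 p+1≤L
      0≤w : 0ℚ ≤ w
      0≤w = *-nonNeg 0≤p+1 0≤h
      w≤L : w ≤ L
      w≤L = subst (w ≤_) (ℚ.*-identityʳ L) (*-mono 0≤p+1 (<⇒≤ 0<1) p+1≤L h≤1)
      lo≤L : lo ≤ L
      lo≤L = ≤-trans (square-cancel-≤ 0≤p+1 (≤-trans lo²≤p
        (subst (p ≤_)
          (solve 1 (λ p → p :+ (con 1ℚ :+ (p :+ p :* p)) := (p :+ con 1ℚ) :* (p :+ con 1ℚ))
            refl p)
          (≤-+-nonNeg (+-nonNeg (<⇒≤ 0<1) (+-nonNeg 0≤p (square-nonNeg p)))))))
        p+1≤L
      p-lo²≤ : p - lo * lo ≤ w * (lo + lo + w)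
      p-lo²≤ = subst (p - lo * lo ≤_)
        (solve 2 (λ l w → (l :+ w) :* (l :+ w) :- l :* l := w :* (l :+ l :+ w)) refl lo w)
        (ℚ.+-monoˡ-≤ (- (lo * lo)) p≤)
      w*≤ : w * (lo + lo + w) ≤ (L * h) * (L + L + L)
      w*≤ = *-mono 0≤w (+-nonNeg (+-nonNeg 0≤L 0≤L) 0≤L)
        (ℚ.*-monoʳ-≤-nonNeg h {{ℚ.nonNegative 0≤h}} p+1≤L)
        (ℚ.+-mono-≤ (ℚ.+-mono-≤ lo≤L lo≤L) w≤L)
      ∣-∣-eq : p - lo * lo ≡ ∣ lo * lo - p ∣ᑫ
      ∣-∣-eq = trans
        (sym (ℚ.0≤p⇒∣p∣≡p (subst (_≤ p - lo * lo) (ℚ.+-inverseʳ (lo * lo))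
          (ℚ.+-monoˡ-≤ (- (lo * lo)) lo²≤p))))
        (∣-∣-sym p (lo * lo))

  ⊔-0-cauchy : ∀ x → Cauchy (λ n → seq x n ⊔ 0ℚ)
  ⊔-0-cauchy x 0<ε =
    let N , close = cauchy x 0<ε
    in N , λ {m} {n} ≤m ≤n →
      ℚ.≤-<-trans (⊔-0-nonexpansive (seq x m) (seq x n)) (close ≤m ≤n)

_⊔0 : ℝ → ℝ
x ⊔0 = mkℝ (λ n → seq x n ⊔ 0ℚ) (⊔-0-cauchy x)

sqrtSeq : ℝ → ℕ → ℚ
sqrtSeq x n = sqrtℚ (seq x n ⊔ 0ℚ) n

abstract

  0≤⊔0 : ∀ p → 0ℚ ≤ p ⊔ 0ℚ
  0≤⊔0 p = ℚ.p≤q⊔p p 0ℚ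

  sqrtSeq-nonNeg : ∀ x n → 0ℚ ≤ sqrtSeq x n
  sqrtSeq-nonNeg x n = proj₁ (sqrtℚ-brackets (0≤⊔0 (seq x n)) n)

  sqrtSeq-square : ∀ x {ε} → 0ℚ < ε → ∃ λ N → ∀ {n} → N ℕ.≤ n →
                   ∣ sqrtSeq x n * sqrtSeq x n - (seq x n ⊔ 0ℚ) ∣ᑫ < ε
  sqrtSeq-square x {ε} 0<ε =
    let K , 0<K , M , p≤K = bounded (x ⊔0)
        L = K + 1ℚ
        0<L = ℚ.+-mono-< 0<K 0<1
        0<C = *-pos 0<L (ℚ.+-mono-< (ℚ.+-mono-< 0<L 0<L) 0<L)
        δ , 0<δ , Cδ≡ε = split 0<C 0<ε
        N , h<δ = 2^-→0 0<δ
    in M ℕ.⊔ N , λ {n} ≤n →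
      ℚ.≤-<-trans
        (sqrtℚ-gap (0≤⊔0 (seq x n)) (<⇒≤ (2^-pos n)) (2^-≤1 n)
          (ℚ.+-monoˡ-≤ 1ℚ (≤-trans (≤-∣-∣ (seq x n ⊔ 0ℚ)) (p≤K (ℕ.m⊔n≤o⇒m≤o M N ≤n))))
          (sqrtℚ-brackets (0≤⊔0 (seq x n)) n))
        (subst (L * (L + L + L) * 2^- n <_) Cδ≡ε
          (ℚ.*-monoʳ-<-pos (L * (L + L + L)) {{ℚ.positive 0<C}} (h<δ (ℕ.m⊔n≤o⇒n≤o M N ≤n))))

  private

    square-close : ∀ {a b p r ε} → 0ℚ ≤ a → 0ℚ ≤ b → 0ℚ < ε →
                   ∣ a * a - p ∣ᑫ < ½ * (ε * ε) → ∣ p - r ∣ᑫ < ½ * (½ * (ε * ε)) →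
                   ∣ b * b - r ∣ᑫ < ½ * (½ * (ε * ε)) → ∣ a - b ∣ᑫ < ε
    square-close {a} {b} {p} {r} {ε} 0≤a 0≤b 0<ε ap pr br = square-cancel-< (<⇒≤ 0<ε)
      (ℚ.≤-<-trans (∣-∣-square-≤ 0≤a 0≤b)
        (ℚ.≤-<-trans (∣-∣-triangle (a * a) p (b * b))
          (subst (∣ a * a - p ∣ᑫ + ∣ p - b * b ∣ᑫ <_) (half+half (ε * ε))
            (ℚ.+-mono-< ap
              (ℚ.≤-<-trans (∣-∣-triangle p r (b * b))
                (subst (∣ p - r ∣ᑫ + ∣ r - b * b ∣ᑫ <_) (half+half (½ * (ε * ε)))
                  (ℚ.+-mono-< pr
                    (subst (_< ½ * (½ * (ε * ε))) (∣-∣-sym (b * b) r) br))))))))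

  sqrt-cauchy : ∀ x → Cauchy (sqrtSeq x)
  sqrt-cauchy x 0<ε =
    let 0<ε²/2  = half-pos (*-pos 0<ε 0<ε)
        0<ε²/4  = half-pos 0<ε²/2
        N₁ , sq₁ = sqrtSeq-square x 0<ε²/2
        N₂ , sq₂ = sqrtSeq-square x 0<ε²/4
        N₃ , close = cauchy (x ⊔0) 0<ε²/4
        N₄ = N₁ ℕ.⊔ N₂
    in N₄ ℕ.⊔ N₃ , λ {m} {n} ≤m ≤n →
      square-close (sqrtSeq-nonNeg x m) (sqrtSeq-nonNeg x n) 0<ε
        (sq₁ (ℕ.m⊔n≤o⇒m≤o N₁ N₂ (ℕ.m⊔n≤o⇒m≤o N₄ N₃ ≤m)))
        (close (ℕ.m⊔n≤o⇒n≤o N₄ N₃ ≤m) (ℕ.m⊔n≤o⇒n≤o N₄ N₃ ≤n))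
        (sq₂ (ℕ.m⊔n≤o⇒n≤o N₁ N₂ (ℕ.m⊔n≤o⇒m≤o N₄ N₃ ≤n)))

-- The square root of max(x, 0).
√_ : ℝ → ℝ
√ x = mkℝ (sqrtSeq x) (sqrt-cauchy x)

abstract

  √<1⇒<1 : ∀ x → √ x <ʳ 1ʳ → x <ʳ 1ʳ
  √<1⇒<1 x (δ , 0<δ , M , y+δ≤1) =
    let N , close = sqrtSeq-square x (half-pos 0<δ)
    in ½ * δ , half-pos 0<δ , M ℕ.⊔ N , λ {n} ≤n →
      bound (sqrtSeq-nonNeg x n) (y+δ≤1 (ℕ.m⊔n≤o⇒m≤o M N ≤n)) (ℚ.p≤p⊔q (seq x n) 0ℚ)
        (close (ℕ.m⊔n≤o⇒n≤o M N ≤n))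
    where
    bound : ∀ {y p r} → 0ℚ ≤ y → y + δ ≤ 1ℚ → p ≤ r → ∣ y * y - r ∣ᑫ < ½ * δ →
            p + ½ * δ ≤ 1ℚ
    bound {y} {p} {r} 0≤y y+δ≤1 p≤r y²-r<½δ = ≤-trans
      (ℚ.+-monoˡ-≤ (½ * δ) (≤-trans p≤r r≤y+½δ))
      (≤-trans
        (≤-reflexive (trans (ℚ.+-assoc y (½ * δ) (½ * δ)) (cong (y +_) (half+half δ))))
        y+δ≤1)
      where
      y≤1 : y ≤ 1ℚ
      y≤1 = ≤-trans (≤-+-nonNeg (<⇒≤ 0<δ)) y+δ≤1
      r≤y+½δ : r ≤ y + ½ * δ
      r≤y+½δ = subst (_≤ y + ½ * δ)
        (solve 2 (λ s r → s :+ (r :- s) := r) refl (y * y) r)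
        (ℚ.+-mono-≤
          (subst (y * y ≤_) (ℚ.*-identityˡ y) (*-mono 0≤y 0≤y y≤1 ≤-refl))
          (≤-trans (≤-∣-∣ (r - y * y))
            (subst (_≤ ½ * δ) (∣-∣-sym (y * y) r) (<⇒≤ y²-r<½δ))))

------------------------------------------------------------------------
-- Complex numbers

record ℂ : Set where
  constructor mkℂ
  field
    re im : ℝ

open ℂ public

infix 4 _≈ᶜ_

_≈ᶜ_ : ℂ → ℂ → Set
w ≈ᶜ v = re w ≈ʳ re v × im w ≈ʳ im v

infixl 6 _+ᶜ_ _-ᶜ_
infixl 7 _*ᶜ_ _÷ᶜ_[_]
infix  8 -ᶜ_

0ᶜ 1ᶜ : ℂ
0ᶜ = mkℂ 0ʳ 0ʳ
1ᶜ = mkℂ 1ʳ 0ʳ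

_+ᶜ_ : ℂ → ℂ → ℂ
w +ᶜ v = mkℂ (re w +ʳ re v) (im w +ʳ im v)

-ᶜ_ : ℂ → ℂ
-ᶜ w = mkℂ (-ʳ re w) (-ʳ im w)

_-ᶜ_ : ℂ → ℂ → ℂ
w -ᶜ v = w +ᶜ -ᶜ v

_*ᶜ_ : ℂ → ℂ → ℂ
w *ᶜ v = mkℂ (re w *ʳ re v +ʳ -ʳ (im w *ʳ im v)) (re w *ʳ im v +ʳ im w *ʳ re v)

normSq : ℂ → ℝ
normSq w = re w *ʳ re w +ʳ im w *ʳ im w

∣_∣ : ℂ → ℝ
∣ w ∣ = √ normSq w

-- Constructive "nonzero": |w|² is bounded away from 0.  Division needs this
-- evidence, but its value does not depend on it.
_#0 : ℂ → Set
w #0 = 0ʳ <ʳ normSq w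

_÷ᶜ_[_] : (w v : ℂ) → v #0 → ℂ
w ÷ᶜ v [ v#0 ] = w *ᶜ mkℂ (re v *ʳ r) (-ʳ (im v *ʳ r))
  where r = normSq v ⁻¹ʳ[ v#0 ]

ℂ-rawRing : RawRing 0ℓ 0ℓ
ℂ-rawRing = record
  { _≈_ = _≈ᶜ_ ; _+_ = _+ᶜ_ ; _*_ = _*ᶜ_ ; -_ = -ᶜ_ ; 0# = 0ᶜ ; 1# = 1ᶜ }

open RawSemiringDefinitions (RawRing.rawSemiring ℂ-rawRing) public using (_^_; sum; product)

------------------------------------------------------------------------
-- Finite sums, limits and series

∑< : ℕ → (ℕ → ℂ) → ℂ
∑< n f = sum {n} (λ i → f (toℕ i))

infix 4 _⟶_

_⟶_ : (ℕ → ℂ) → ℂ → Set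
u ⟶ w = ∀ ε → 0ʳ <ʳ ε → ∃ λ N → ∀ n → N ℕ.≤ n → ∣ u n -ᶜ w ∣ <ʳ ε

-- The series f 1 + f 2 + f 3 + ⋯ converges to w.
HasSum₁ : (ℕ → ℂ) → ℂ → Set
HasSum₁ f w = (λ M → ∑< M (λ m → f (suc m))) ⟶ w

------------------------------------------------------------------------
-- q-Pochhammer symbols

pochhammer : ℂ → ℂ → ℕ → ℂ
pochhammer a q n = product {n} (λ i → 1ᶜ -ᶜ a *ᶜ q ^ toℕ i)

-- Pochhammer∞ a q w says that (a;q)_∞ converges to w.
Pochhammer∞ : ℂ → ℂ → ℂ → Set
Pochhammer∞ a q w = pochhammer a q ⟶ w

abstract

  private

    NormSqℚ : ℚ → ℚ → ℚ
    NormSqℚ a b = a * a + b * b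

    normSq-* : ∀ a b c d → NormSqℚ (a * c + - (b * d)) (a * d + b * c) ≡
                           NormSqℚ a b * NormSqℚ c d
    normSq-* = solve 4 (λ a b c d →
      (a :* c :+ :- (b :* d)) :* (a :* c :+ :- (b :* d)) :+
      (a :* d :+ b :* c) :* (a :* d :+ b :* c) :=
      (a :* a :+ b :* b) :* (c :* c :+ d :* d)) refl

    normSq-*-seq : ∀ w v n → seq (normSq (w *ᶜ v)) n ≡ seq (normSq w) n * seq (normSq v) n
    normSq-*-seq w v n =
      normSq-* (seq (re w) n) (seq (im w) n) (seq (re v) n) (seq (im v) n)

    normSq-nonNeg : ∀ w n → 0ℚ ≤ seq (normSq w) n
    normSq-nonNeg w n = +-nonNeg (square-nonNeg (seq (re w) n)) (square-nonNeg (seq (im w) n))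

    #0-* : ∀ w v → w #0 → v #0 → (w *ᶜ v) #0
    #0-* w v (δ , 0<δ , M , δ≤) (η , 0<η , N , η≤) =
      δ * η , *-pos 0<δ 0<η , M ℕ.⊔ N , λ {n} ≤n →
        subst₂ _≤_ (sym (ℚ.+-identityˡ (δ * η))) (sym (normSq-*-seq w v n))
          (*-mono (<⇒≤ 0<δ) (normSq-nonNeg v n)
            (subst (_≤ seq (normSq w) n) (ℚ.+-identityˡ δ) (δ≤ (ℕ.m⊔n≤o⇒m≤o M N ≤n)))
            (subst (_≤ seq (normSq v) n) (ℚ.+-identityˡ η) (η≤ (ℕ.m⊔n≤o⇒n≤o M N ≤n))))

    1#0 : 1ᶜ #0
    1#0 = 1ℚ , 0<1 , 0 , λ _ → ≤-refl

    product-#0 : ∀ {n} (f : Fin n → ℂ) → (∀ i → f i #0) → product f #0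
    product-#0 {zero}  f f#0 = 1#0
    product-#0 {suc n} f f#0 = #0-* (f Fin.zero) (product (λ i → f (Fin.suc i)))
      (f#0 Fin.zero) (product-#0 (λ i → f (Fin.suc i)) (λ i → f#0 (Fin.suc i)))

    normSq-^≤1 : ∀ w n → seq (normSq w) n ≤ 1ℚ → ∀ i → seq (normSq (w ^ i)) n ≤ 1ℚ
    normSq-^≤1 w n ≤1 zero    = ≤-refl
    normSq-^≤1 w n ≤1 (suc i) = subst (_≤ 1ℚ) (sym (normSq-*-seq w (w ^ i) n))
      (*-mono (normSq-nonNeg w n) (<⇒≤ 0<1) ≤1 (normSq-^≤1 w n ≤1 i))

    normSq-^suc≤ : ∀ w n → seq (normSq w) n ≤ 1ℚ → ∀ i →
                   seq (normSq (w *ᶜ w ^ i)) n ≤ seq (normSq w) n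
    normSq-^suc≤ w n ≤1 i = subst₂ _≤_
      (sym (normSq-*-seq w (w ^ i) n)) (ℚ.*-identityʳ (seq (normSq w) n))
      (*-mono (normSq-nonNeg w n) (<⇒≤ 0<1) ≤-refl (normSq-^≤1 w n ≤1 i))

    1-≥ : ∀ {a b c δ} → 0ℚ < δ → NormSqℚ a b ≤ c → c + δ ≤ 1ℚ →
          (½ * δ) * (½ * δ) ≤ NormSqℚ (1ℚ + - a) (0ℚ + - b)
    1-≥ {a} {b} {c} {δ} 0<δ ≤c c+δ≤1 = ≤-trans
      (*-mono (<⇒≤ 0<½δ) (≤-trans (<⇒≤ 0<½δ) ½δ≤1-a) ½δ≤1-a ½δ≤1-a)
      (≤-+-nonNeg (square-nonNeg (0ℚ + - b)))
      where
      0<½δ : 0ℚ < ½ * δ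
      0<½δ = half-pos 0<δ
      c≤1-δ : c ≤ 1ℚ - δ
      c≤1-δ = subst (_≤ 1ℚ - δ)
        (solve 2 (λ c d → (c :+ d) :- d := c) refl c δ) (ℚ.+-monoˡ-≤ (- δ) c+δ≤1)
      a²≤1-δ : a * a ≤ 1ℚ - δ
      a²≤1-δ = ≤-trans (≤-+-nonNeg (square-nonNeg b)) (≤-trans ≤c c≤1-δ)
      0≤1-½δ : 0ℚ ≤ 1ℚ - ½ * δ
      0≤1-½δ = subst (0ℚ ≤_)
        (solve 1 (λ d → (con 1ℚ :- d) :+ con ½ :* d := con 1ℚ :- con ½ :* d) refl δ)
        (+-nonNeg (≤-trans (square-nonNeg a) a²≤1-δ) (<⇒≤ 0<½δ))
      a≤1-½δ : a ≤ 1ℚ - ½ * δ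
      a≤1-½δ = square-cancel-≤ 0≤1-½δ (≤-trans a²≤1-δ
        (subst (1ℚ - δ ≤_)
          (solve 1 (λ d → (con 1ℚ :- d) :+ (con ½ :* d) :* (con ½ :* d) :=
                          (con 1ℚ :- con ½ :* d) :* (con 1ℚ :- con ½ :* d)) refl δ)
          (≤-+-nonNeg (square-nonNeg (½ * δ)))))
      ½δ≤1-a : ½ * δ ≤ 1ℚ + - a
      ½δ≤1-a = subst₂ _≤_
        (solve 2 (λ a h → a :+ (h :- a) := h) refl a (½ * δ))
        (solve 2 (λ a h → (con 1ℚ :- h) :+ (h :- a) := con 1ℚ :+ :- a) refl a (½ * δ))
        (ℚ.+-monoˡ-≤ (½ * δ - a) a≤1-½δ)

    1-q^suc#0 : ∀ q → normSq q <ʳ 1ʳ → ∀ i → (1ᶜ -ᶜ q *ᶜ q ^ i) #0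
    1-q^suc#0 q (δ , 0<δ , N , q+δ≤1) i =
      (½ * δ) * (½ * δ) , *-pos (half-pos 0<δ) (half-pos 0<δ) , N , λ {n} N≤n →
        subst (_≤ seq (normSq (1ᶜ -ᶜ q *ᶜ q ^ i)) n) (sym (ℚ.+-identityˡ ((½ * δ) * (½ * δ))))
          (1-≥ {seq (re (q *ᶜ q ^ i)) n} {seq (im (q *ᶜ q ^ i)) n} 0<δ
            (normSq-^suc≤ q n (≤-trans (≤-+-nonNeg (<⇒≤ 0<δ)) (q+δ≤1 N≤n)) i)
            (q+δ≤1 N≤n))

  pochhammer#0 : ∀ {q} → ∣ q ∣ <ʳ 1ʳ → ∀ n → pochhammer q q n #0
  pochhammer#0 {q} ∣q∣<1 n =
    product-#0 {n} (λ i → 1ᶜ -ᶜ q *ᶜ q ^ toℕ i)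
      (λ i → 1-q^suc#0 q (√<1⇒<1 (normSq q) ∣q∣<1) (toℕ i))

{-# OPTIONS --safe #-}

-- Count partitions λ into distinct parts by z^(number of parts) q^(size), and let D n s
-- count those with at most s parts exceeding n.  Raising n by one adds G n s, raising s
-- by one adds F n (s + 1), so a staircase path from (0, 0), where D is 1, to (kM, ℓM)
-- writes D (kM) (ℓM) as 1 plus the M-th partial sums of the two series.  Both F and G
-- decay geometrically in n + s, hence the series converge, and going instead along the
-- axis s = 0, where D n 0 = (-zq;q)_n, shows that D (kM) (ℓM) tends to (-zq;q)_∞.
-- The identities hold and the estimates are uniform at the Gaussian rationals that make
-- up the Cauchy sequences of q and z, so the sums can be taken along the diagonal.

module Submission where

open import Data.Nat.Base using (ℕ; NonZero; _+_; _*_; _∸_; _/_)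
open import Data.Product.Base using (∃; _×_)
open import Defs

open import Algebra.Bundles using (CommutativeRing; Semiring)
open import Algebra.Structures using (IsCommutativeRing)
import Algebra.Definitions.RawSemiring as RawSemiringDefinitions
import Algebra.Properties.Semiring.Exp as Exp
import Algebra.Solver.Ring.AlmostCommutativeRing as ACR
import Algebra.Solver.Ring.Simple as RingSolver
open import Data.Fin.Base as Fin using (Fin; toℕ)
open import Data.Nat.Base as ℕ using (zero; suc)
import Data.Nat.DivMod as ℕ
import Data.Nat.Properties as ℕ
import Data.Nat.Solver as ℕ
open import Data.Product.Base using (_,_; proj₁; proj₂)
open import Data.Rational.Base as ℚ using (ℚ; 0ℚ; 1ℚ; ½)
  renaming (_+_ to _+ᑫ_; _*_ to _*ᑫ_; _-_ to _-ᑫ_; -_ to -ᑫ_; _≤_ to _≤ᑫ_; _<_ to _<ᑫ_; ∣_∣ to ∣_∣ᑫ)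
import Data.Rational.Properties as ℚ
import Data.Rational.Solver as ℚ
open import Function.Base using (_∘_)
open import Level using (0ℓ)
open import Relation.Binary.Definitions using (DecidableEquality)
open import Relation.Binary.PropositionalEquality
  using (_≡_; refl; sym; trans; cong; cong₂; subst; subst₂; isEquivalence; module ≡-Reasoning)
open import Relation.Nullary using (yes; no)

open RawSemiringDefinitions ℚ.+-*-rawSemiring using () renaming (_^_ to _^ᑫ_)
module ^ᑫ = Exp (CommutativeRing.semiring ℚ.+-*-commutativeRing)
open ℕ.+-*-Solver using ()
  renaming (solve to ℕ-solve; con to con′; _:+_ to _⊞_; _:*_ to _⊠_; _:=_ to _≐_)
open ℚ.+-*-Solver using (solve; con; _:+_; _:*_; _:-_; :-_; _:=_)

-- The obstacle is that both series need actual sums: a complex number is a pair of Cauchy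
-- sequences, so each limit has to be built as a sequence together with its modulus of convergence.
-- All arithmetic acts index by index, so at a fixed index every identity becomes an exact equation
-- in `ℚ[i]`. Two things can go wrong at an early index: the approximation of q may have modulus at
-- least 1, and a denominator may vanish, its reciprocal then being set to 0. Both are excluded
-- beyond a single threshold that does not depend on how many terms are summed; this uniformity is
-- what lets the number of terms grow with the index. The value of the infinite product is taken to
-- be 1 + S + T itself, so the final equation is reflexivity and the analytic content lies in the
-- convergence of the finite products to that value.

infixl 6 _+ᵍ_ _-ᵍ_
infixl 7 _*ᵍ_
infix  8 -ᵍ_

-- Gaussian rationals

record ℚ[i] : Set where
  constructor mkℚ[i]
  field
    reᵍ imᵍ : ℚ

open ℚ[i]

0ᵍ 1ᵍ : ℚ[i]
0ᵍ = mkℚ[i] 0ℚ 0ℚ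
1ᵍ = mkℚ[i] 1ℚ 0ℚ

_+ᵍ_ : ℚ[i] → ℚ[i] → ℚ[i]
w +ᵍ v = mkℚ[i] (reᵍ w +ᑫ reᵍ v) (imᵍ w +ᑫ imᵍ v)

-ᵍ_ : ℚ[i] → ℚ[i]
-ᵍ w = mkℚ[i] (-ᑫ reᵍ w) (-ᑫ imᵍ w)

_-ᵍ_ : ℚ[i] → ℚ[i] → ℚ[i]
w -ᵍ v = w +ᵍ -ᵍ v

_*ᵍ_ : ℚ[i] → ℚ[i] → ℚ[i]
w *ᵍ v = mkℚ[i] (reᵍ w *ᑫ reᵍ v +ᑫ -ᑫ (imᵍ w *ᑫ imᵍ v)) (reᵍ w *ᑫ imᵍ v +ᑫ imᵍ w *ᑫ reᵍ v)

normSqᵍ : ℚ[i] → ℚ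
normSqᵍ w = reᵍ w *ᑫ reᵍ w +ᑫ imᵍ w *ᑫ imᵍ w

invᵍ : ℚ[i] → ℚ[i]
invᵍ v = mkℚ[i] (reᵍ v *ᑫ r) (-ᑫ (imᵍ v *ᑫ r))
  where r = recip (normSqᵍ v)

_≟ᵍ_ : DecidableEquality ℚ[i]
mkℚ[i] a b ≟ᵍ mkℚ[i] c d with a ℚ.≟ c | b ℚ.≟ d
... | yes refl | yes refl = yes refl
... | no a≢c   | _        = no λ { refl → a≢c refl }
... | yes _    | no b≢d   = no λ { refl → b≢d refl }

abstract

  private

    *ᵍ-assoc : ∀ u v w → u *ᵍ v *ᵍ w ≡ u *ᵍ (v *ᵍ w)
    *ᵍ-assoc (mkℚ[i] a b) (mkℚ[i] c d) (mkℚ[i] e f) = cong₂ mkℚ[i]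
      (solve 6 (λ a b c d e f →
        (a :* c :+ :- (b :* d)) :* e :+ :- ((a :* d :+ b :* c) :* f) :=
        a :* (c :* e :+ :- (d :* f)) :+ :- (b :* (c :* f :+ d :* e))) refl a b c d e f)
      (solve 6 (λ a b c d e f →
        (a :* c :+ :- (b :* d)) :* f :+ (a :* d :+ b :* c) :* e :=
        a :* (c :* f :+ d :* e) :+ b :* (c :* e :+ :- (d :* f))) refl a b c d e f)

    *ᵍ-comm : ∀ u v → u *ᵍ v ≡ v *ᵍ u
    *ᵍ-comm (mkℚ[i] a b) (mkℚ[i] c d) = cong₂ mkℚ[i]
      (solve 4 (λ a b c d → a :* c :+ :- (b :* d) := c :* a :+ :- (d :* b)) refl a b c d)
      (solve 4 (λ a b c d → a :* d :+ b :* c := c :* b :+ d :* a) refl a b c d)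

    *ᵍ-identityˡ : ∀ u → 1ᵍ *ᵍ u ≡ u
    *ᵍ-identityˡ (mkℚ[i] a b) = cong₂ mkℚ[i]
      (solve 2 (λ a b → con 1ℚ :* a :+ :- (con 0ℚ :* b) := a) refl a b)
      (solve 2 (λ a b → con 1ℚ :* b :+ con 0ℚ :* a := b) refl a b)

    *ᵍ-distribʳ-+ᵍ : ∀ u v w → (v +ᵍ w) *ᵍ u ≡ v *ᵍ u +ᵍ w *ᵍ u
    *ᵍ-distribʳ-+ᵍ (mkℚ[i] e f) (mkℚ[i] a b) (mkℚ[i] c d) = cong₂ mkℚ[i]
      (solve 6 (λ a b c d e f →
        (a :+ c) :* e :+ :- ((b :+ d) :* f) :=
        (a :* e :+ :- (b :* f)) :+ (c :* e :+ :- (d :* f))) refl a b c d e f)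
      (solve 6 (λ a b c d e f →
        (a :+ c) :* f :+ (b :+ d) :* e :=
        (a :* f :+ b :* e) :+ (c :* f :+ d :* e)) refl a b c d e f)

  ℚ[i]-isCommutativeRing : IsCommutativeRing _≡_ _+ᵍ_ _*ᵍ_ (λ u → -ᵍ u) 0ᵍ 1ᵍ
  ℚ[i]-isCommutativeRing = record
    { isRing = record
      { +-isAbelianGroup = record
        { isGroup = record
          { isMonoid = record
            { isSemigroup = record
              { isMagma = record { isEquivalence = isEquivalence ; ∙-cong = cong₂ _+ᵍ_ }
              ; assoc = λ u v w → cong₂ mkℚ[i]
                  (ℚ.+-assoc (reᵍ u) (reᵍ v) (reᵍ w)) (ℚ.+-assoc (imᵍ u) (imᵍ v) (imᵍ w))
              }
            ; identity =
                (λ u → cong₂ mkℚ[i] (ℚ.+-identityˡ (reᵍ u)) (ℚ.+-identityˡ (imᵍ u)))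
              , (λ u → cong₂ mkℚ[i] (ℚ.+-identityʳ (reᵍ u)) (ℚ.+-identityʳ (imᵍ u)))
            }
          ; inverse =
              (λ u → cong₂ mkℚ[i] (ℚ.+-inverseˡ (reᵍ u)) (ℚ.+-inverseˡ (imᵍ u)))
            , (λ u → cong₂ mkℚ[i] (ℚ.+-inverseʳ (reᵍ u)) (ℚ.+-inverseʳ (imᵍ u)))
          ; ⁻¹-cong = cong (λ u → -ᵍ u)
          }
        ; comm = λ u v → cong₂ mkℚ[i] (ℚ.+-comm (reᵍ u) (reᵍ v)) (ℚ.+-comm (imᵍ u) (imᵍ v))
        }
      ; *-cong = cong₂ _*ᵍ_
      ; *-assoc = *ᵍ-assoc
      ; *-identity = *ᵍ-identityˡ , (λ u → trans (*ᵍ-comm u 1ᵍ) (*ᵍ-identityˡ u))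
      ; distrib =
          (λ u v w → trans (*ᵍ-comm u (v +ᵍ w))
            (trans (*ᵍ-distribʳ-+ᵍ u v w) (cong₂ _+ᵍ_ (*ᵍ-comm v u) (*ᵍ-comm w u))))
        , *ᵍ-distribʳ-+ᵍ
      }
    ; *-comm = *ᵍ-comm
    }

ℚ[i]-commutativeRing : CommutativeRing 0ℓ 0ℓ
ℚ[i]-commutativeRing = record { isCommutativeRing = ℚ[i]-isCommutativeRing }

module ℚᵢ = CommutativeRing ℚ[i]-commutativeRing

module ℚ[i]-Solver = RingSolver (ACR.fromCommutativeRing ℚ[i]-commutativeRing) _≟ᵍ_
open ℚ[i]-Solver using ()
  renaming (solve to solveᵍ; con to conᵍ; _:+_ to _⊕_; _:*_ to _⊗_; _:-_ to _⊖_; :-_ to ⊝_; _:=_ to _⊜_)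

open RawSemiringDefinitions (Semiring.rawSemiring ℚᵢ.semiring) using ()
  renaming (_^_ to _^ᵍ_; sum to sumᵍ; product to productᵍ)
module ^ᵍ = Exp ℚᵢ.semiring

∑ᵍ< : ℕ → (ℕ → ℚ[i]) → ℚ[i]
∑ᵍ< n f = sumᵍ {n} (λ i → f (toℕ i))

abstract

  normSqᵍ-* : ∀ w v → normSqᵍ (w *ᵍ v) ≡ normSqᵍ w *ᑫ normSqᵍ v
  normSqᵍ-* (mkℚ[i] a b) (mkℚ[i] c d) = solve 4 (λ a b c d →
    (a :* c :+ :- (b :* d)) :* (a :* c :+ :- (b :* d)) :+
    (a :* d :+ b :* c) :* (a :* d :+ b :* c) :=
    (a :* a :+ b :* b) :* (c :* c :+ d :* d)) refl a b c d

  normSqᵍ-nonNeg : ∀ w → 0ℚ ≤ᑫ normSqᵍ w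
  normSqᵍ-nonNeg w = +-nonNeg (square-nonNeg (reᵍ w)) (square-nonNeg (imᵍ w))

  *ᵍ-inverseʳ : ∀ v → 0ℚ <ᑫ normSqᵍ v → v *ᵍ invᵍ v ≡ 1ᵍ
  *ᵍ-inverseʳ v@(mkℚ[i] a b) 0<Nv = cong₂ mkℚ[i]
    (trans (solve 3 (λ a b r → a :* (a :* r) :+ :- (b :* (:- (b :* r))) :=
                               (a :* a :+ b :* b) :* r) refl a b (recip (normSqᵍ v)))
      (*-recip 0<Nv))
    (solve 3 (λ a b r → a :* (:- (b :* r)) :+ b :* (a :* r) := con 0ℚ)
      refl a b (recip (normSqᵍ v)))

  -- The norm is multiplicative, so `normSqᵍ v ≤ 0` would give 1 ≤ 0.
  normSqᵍ-unit-pos : ∀ v w → v *ᵍ w ≡ 1ᵍ → 0ℚ <ᑫ normSqᵍ v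
  normSqᵍ-unit-pos v w vw≡1 = ℚ.≰⇒> λ Nv≤0 →
    ℚ.<-irrefl refl (ℚ.<-≤-trans 0<1 (subst (_≤ᑫ 0ℚ)
      (trans (sym (normSqᵍ-* v w)) (cong normSqᵍ vw≡1))
      (subst (normSqᵍ v *ᑫ normSqᵍ w ≤ᑫ_) (ℚ.*-zeroˡ (normSqᵍ w))
        (ℚ.*-monoʳ-≤-nonNeg (normSqᵍ w) {{ℚ.nonNegative (normSqᵍ-nonNeg w)}} Nv≤0))))

  -- Serves to identify the inverse of a Pochhammer product with the product of inverses `1/[q]`,
  -- given only that the two multiply to 1.
  invᵍ-unique : ∀ v w → v *ᵍ w ≡ 1ᵍ → invᵍ v ≡ w
  invᵍ-unique v w vw≡1 = begin
    invᵍ v              ≡⟨ ℚᵢ.*-identityʳ (invᵍ v) ⟨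
    invᵍ v *ᵍ 1ᵍ        ≡⟨ cong (invᵍ v *ᵍ_) vw≡1 ⟨
    invᵍ v *ᵍ (v *ᵍ w)  ≡⟨ ℚᵢ.*-assoc (invᵍ v) v w ⟨
    invᵍ v *ᵍ v *ᵍ w    ≡⟨ cong (_*ᵍ w) (ℚᵢ.*-comm (invᵍ v) v) ⟩
    v *ᵍ invᵍ v *ᵍ w    ≡⟨ cong (_*ᵍ w) (*ᵍ-inverseʳ v (normSqᵍ-unit-pos v w vw≡1)) ⟩
    1ᵍ *ᵍ w             ≡⟨ ℚᵢ.*-identityˡ w ⟩
    w                   ∎
    where open ≡-Reasoning

-- Sizes of Gaussian rationals

infix 4 _≼_

-- The modulus is bounded without being named, as it need not be rational.
record _≼_ (w : ℚ[i]) (b : ℚ) : Set where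
  constructor mk≼
  field
    nonNeg    : 0ℚ ≤ᑫ b
    normSqᵍ-≤ : normSqᵍ w ≤ᑫ b *ᑫ b

abstract

  ≼-weaken : ∀ {w b c} → w ≼ b → b ≤ᑫ c → w ≼ c
  ≼-weaken (mk≼ 0≤b Nw≤) b≤c =
    mk≼ (ℚ.≤-trans 0≤b b≤c) (ℚ.≤-trans Nw≤ (*-mono 0≤b (ℚ.≤-trans 0≤b b≤c) b≤c b≤c))

  0ᵍ-≼ : ∀ {b} → 0ℚ ≤ᑫ b → 0ᵍ ≼ b
  0ᵍ-≼ 0≤b = mk≼ 0≤b (*-nonNeg 0≤b 0≤b)

  1ᵍ-≼ : 1ᵍ ≼ 1ℚ
  1ᵍ-≼ = mk≼ (ℚ.<⇒≤ 0<1) ℚ.≤-refl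

  -ᵍ-≼ : ∀ {w b} → w ≼ b → -ᵍ w ≼ b
  -ᵍ-≼ {w} {b} (mk≼ 0≤b Nw≤) = mk≼ 0≤b (subst (_≤ᑫ b *ᑫ b)
    (solve 2 (λ a b → a :* a :+ b :* b := (:- a) :* (:- a) :+ (:- b) :* (:- b))
      refl (reᵍ w) (imᵍ w)) Nw≤)

  *ᵍ-≼ : ∀ {w v b c} → w ≼ b → v ≼ c → w *ᵍ v ≼ b *ᑫ c
  *ᵍ-≼ {w} {v} {b} {c} (mk≼ 0≤b Nw≤) (mk≼ 0≤c Nv≤) = mk≼ (*-nonNeg 0≤b 0≤c)
    (subst₂ _≤ᑫ_ (sym (normSqᵍ-* w v))
      (solve 2 (λ b c → (b :* b) :* (c :* c) := (b :* c) :* (b :* c)) refl b c)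
      (*-mono (normSqᵍ-nonNeg w) (*-nonNeg 0≤c 0≤c) Nw≤ Nv≤))

  ^ᵍ-≼ : ∀ {w b} → w ≼ b → ∀ n → w ^ᵍ n ≼ b ^ᑫ n
  ^ᵍ-≼ w≼b zero    = 1ᵍ-≼
  ^ᵍ-≼ w≼b (suc n) = *ᵍ-≼ w≼b (^ᵍ-≼ w≼b n)

  -- The Cauchy-Schwarz inequality bounds the cross term.
  +ᵍ-≼ : ∀ {w v b c} → w ≼ b → v ≼ c → w +ᵍ v ≼ b +ᑫ c
  +ᵍ-≼ {w@(mkℚ[i] x y)} {v@(mkℚ[i] s t)} {b} {c} (mk≼ 0≤b Nw≤) (mk≼ 0≤c Nv≤) =
    mk≼ (+-nonNeg 0≤b 0≤c) (subst₂ _≤ᑫ_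
      (solve 4 (λ x y s t → (x :* x :+ y :* y) :+ (s :* s :+ t :* t) :+
          ((x :* s :+ y :* t) :+ (x :* s :+ y :* t)) :=
        (x :+ s) :* (x :+ s) :+ (y :+ t) :* (y :+ t)) refl x y s t)
      (solve 2 (λ b c → b :* b :+ c :* c :+ (b :* c :+ b :* c) := (b :+ c) :* (b :+ c))
        refl b c)
      (ℚ.+-mono-≤ (ℚ.+-mono-≤ Nw≤ Nv≤) (ℚ.+-mono-≤ cross≤ cross≤)))
    where
    cross≤ : x *ᑫ s +ᑫ y *ᑫ t ≤ᑫ b *ᑫ c
    cross≤ = square-cancel-≤ (*-nonNeg 0≤b 0≤c) (ℚ.≤-trans
      (≤-+-nonNeg (square-nonNeg (x *ᑫ t -ᑫ y *ᑫ s)))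
      (subst₂ _≤ᑫ_
        (solve 4 (λ x y s t → (x :* x :+ y :* y) :* (s :* s :+ t :* t) :=
          (x :* s :+ y :* t) :* (x :* s :+ y :* t) :+
          (x :* t :- y :* s) :* (x :* t :- y :* s)) refl x y s t)
        (solve 2 (λ b c → (b :* b) :* (c :* c) := (b :* c) :* (b :* c)) refl b c)
        (*-mono (normSqᵍ-nonNeg w) (*-nonNeg 0≤c 0≤c) Nw≤ Nv≤)))

  ∣-∣-square : ∀ p → ∣ p ∣ᑫ *ᑫ ∣ p ∣ᑫ ≡ p *ᑫ p
  ∣-∣-square p = trans (sym (ℚ.∣p*q∣≡∣p∣*∣q∣ p p)) (ℚ.0≤p⇒∣p∣≡p (square-nonNeg p))

  ∣reᵍ∣≤ : ∀ {w b} → w ≼ b → ∣ reᵍ w ∣ᑫ ≤ᑫ b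
  ∣reᵍ∣≤ {w} (mk≼ 0≤b Nw≤) = square-cancel-≤ 0≤b (subst (_≤ᑫ _) (sym (∣-∣-square (reᵍ w)))
    (ℚ.≤-trans (≤-+-nonNeg (square-nonNeg (imᵍ w))) Nw≤))

  ∣imᵍ∣≤ : ∀ {w b} → w ≼ b → ∣ imᵍ w ∣ᑫ ≤ᑫ b
  ∣imᵍ∣≤ {w} (mk≼ 0≤b Nw≤) = square-cancel-≤ 0≤b (subst (_≤ᑫ _) (sym (∣-∣-square (imᵍ w)))
    (ℚ.≤-trans (≤-+-nonNeg (square-nonNeg (reᵍ w)))
      (subst (_≤ᑫ _) (ℚ.+-comm (reᵍ w *ᑫ reᵍ w) (imᵍ w *ᑫ imᵍ w)) Nw≤)))

  -- The real part alone suffices: 1 - Re w is at least 1 - r, and the imaginary part only adds a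
  -- square.
  1-≽ : ∀ {w r} → w ≼ r → r ≤ᑫ 1ℚ → (1ℚ -ᑫ r) *ᑫ (1ℚ -ᑫ r) ≤ᑫ normSqᵍ (1ᵍ -ᵍ w)
  1-≽ {w} {r} w≼r r≤1 = ℚ.≤-trans
    (*-mono 0≤1-r (ℚ.≤-trans 0≤1-r 1-r≤) 1-r≤ 1-r≤)
    (≤-+-nonNeg (square-nonNeg (0ℚ +ᑫ -ᑫ imᵍ w)))
    where
    0≤1-r : 0ℚ ≤ᑫ 1ℚ -ᑫ r
    0≤1-r = subst (_≤ᑫ 1ℚ -ᑫ r) (ℚ.+-inverseʳ r) (ℚ.+-monoˡ-≤ (-ᑫ r) r≤1)
    1-r≤ : 1ℚ -ᑫ r ≤ᑫ 1ℚ +ᑫ -ᑫ reᵍ w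
    1-r≤ = ℚ.+-monoʳ-≤ 1ℚ (ℚ.neg-antimono-≤ (ℚ.≤-trans (≤-∣-∣ (reᵍ w)) (∣reᵍ∣≤ w≼r)))

  -- `d` is a lower bound for the modulus and `c` its reciprocal. Scaling `d²≤` by `ρ c²` turns its
  -- left side into `ρ`, the norm of `invᵍ v`, and its right side into `c²`.
  invᵍ-≼ : ∀ {v d c} → 0ℚ <ᑫ d → d *ᑫ c ≡ 1ℚ → 0ℚ ≤ᑫ c → d *ᑫ d ≤ᑫ normSqᵍ v → invᵍ v ≼ c
  invᵍ-≼ {v@(mkℚ[i] a b)} {d} {c} 0<d dc≡1 0≤c d²≤ = mk≼ 0≤c (subst₂ _≤ᑫ_
    (begin
      (ρ *ᑫ (c *ᑫ c)) *ᑫ (d *ᑫ d)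
        ≡⟨ solve 3 (λ ρ c d → (ρ :* (c :* c)) :* (d :* d) := ρ :* ((d :* c) :* (d :* c)))
             refl ρ c d ⟩
      ρ *ᑫ ((d *ᑫ c) *ᑫ (d *ᑫ c))
        ≡⟨ cong (λ e → ρ *ᑫ (e *ᑫ e)) dc≡1 ⟩
      ρ *ᑫ 1ℚ
        ≡⟨ cong (ρ *ᑫ_) (*-recip 0<N) ⟨
      ρ *ᑫ (normSqᵍ v *ᑫ ρ)
        ≡⟨ solve 3 (λ a b r → r :* ((a :* a :+ b :* b) :* r) :=
             (a :* r) :* (a :* r) :+ (:- (b :* r)) :* (:- (b :* r))) refl a b ρ ⟩
      normSqᵍ (invᵍ v) ∎)
    (begin
      (ρ *ᑫ (c *ᑫ c)) *ᑫ normSqᵍ v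
        ≡⟨ solve 3 (λ ρ c n → (ρ :* c) :* n := (n :* ρ) :* c) refl ρ (c *ᑫ c) (normSqᵍ v) ⟩
      (normSqᵍ v *ᑫ ρ) *ᑫ (c *ᑫ c)
        ≡⟨ cong (_*ᑫ (c *ᑫ c)) (*-recip 0<N) ⟩
      1ℚ *ᑫ (c *ᑫ c)
        ≡⟨ ℚ.*-identityˡ (c *ᑫ c) ⟩
      c *ᑫ c ∎)
    (ℚ.*-monoˡ-≤-nonNeg (ρ *ᑫ (c *ᑫ c))
      {{ℚ.nonNegative (*-nonNeg (ℚ.<⇒≤ (recip-pos 0<N)) (*-nonNeg 0≤c 0≤c))}} d²≤))
    where
    open ≡-Reasoning
    ρ : ℚ
    ρ = recip (normSqᵍ v)
    0<N : 0ℚ <ᑫ normSqᵍ v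
    0<N = ℚ.<-≤-trans (*-pos 0<d 0<d) d²≤

-- Geometric decay

abstract

  ^ᑫ-nonNeg : ∀ {r} → 0ℚ ≤ᑫ r → ∀ n → 0ℚ ≤ᑫ r ^ᑫ n
  ^ᑫ-nonNeg 0≤r zero    = ℚ.<⇒≤ 0<1
  ^ᑫ-nonNeg 0≤r (suc n) = *-nonNeg 0≤r (^ᑫ-nonNeg 0≤r n)

  ^ᑫ-≤1 : ∀ {r} → 0ℚ ≤ᑫ r → r ≤ᑫ 1ℚ → ∀ n → r ^ᑫ n ≤ᑫ 1ℚ
  ^ᑫ-≤1 0≤r r≤1 zero    = ℚ.≤-refl
  ^ᑫ-≤1 0≤r r≤1 (suc n) = *-mono 0≤r (ℚ.<⇒≤ 0<1) r≤1 (^ᑫ-≤1 0≤r r≤1 n)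

  ^ᑫ-antimono : ∀ {r} → 0ℚ ≤ᑫ r → r ≤ᑫ 1ℚ → ∀ {m n} → m ℕ.≤ n → r ^ᑫ n ≤ᑫ r ^ᑫ m
  ^ᑫ-antimono 0≤r r≤1 {n = n} ℕ.z≤n = ^ᑫ-≤1 0≤r r≤1 n
  ^ᑫ-antimono {r} 0≤r r≤1 (ℕ.s≤s m≤n) =
    ℚ.*-monoˡ-≤-nonNeg r {{ℚ.nonNegative 0≤r}} (^ᑫ-antimono 0≤r r≤1 m≤n)

  *-nonExpansiveʳ : ∀ {p r} → 0ℚ ≤ᑫ p → r ≤ᑫ 1ℚ → p *ᑫ r ≤ᑫ p
  *-nonExpansiveʳ {p} {r} 0≤p r≤1 = subst (p *ᑫ r ≤ᑫ_) (ℚ.*-identityʳ p)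
    (ℚ.*-monoˡ-≤-nonNeg p {{ℚ.nonNegative 0≤p}} r≤1)

  0<1- : ∀ {r} → r <ᑫ 1ℚ → 0ℚ <ᑫ 1ℚ -ᑫ r
  0<1- {r} r<1 = subst (_<ᑫ 1ℚ -ᑫ r) (ℚ.+-inverseʳ r) (ℚ.+-monoˡ-< (-ᑫ r) r<1)

  private

    -- Bernoulli's inequality along powers of 2: squaring y ≤ t / (t + h) gives
    -- y² ≤ ½t / (½t + h).
    square-step : ∀ {y t h} → 0ℚ ≤ᑫ y → 0ℚ <ᑫ t → 0ℚ ≤ᑫ h → y *ᑫ (t +ᑫ h) ≤ᑫ t →
                  (y *ᑫ y) *ᑫ (½ *ᑫ t +ᑫ h) ≤ᑫ ½ *ᑫ t
    square-step {y} {t} {h} 0≤y 0<t 0≤h y[t+h]≤t =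
      ℚ.*-cancelʳ-≤-pos (t +ᑫ t) {{ℚ.positive (ℚ.+-mono-< 0<t 0<t)}} (ℚ.≤-trans
        (subst (_≤ᑫ (y *ᑫ (t +ᑫ h)) *ᑫ (y *ᑫ (t +ᑫ h)) )
          (solve 3 (λ y t h → (y :* (t :+ h)) :* (y :* (t :+ h)) :- (y :* h) :* (y :* h) :=
            (y :* y) :* (con ½ :* t :+ h) :* (t :+ t)) refl y t h)
          (subst (Y *ᑫ Y -ᑫ H *ᑫ H ≤ᑫ_) (ℚ.+-identityʳ (Y *ᑫ Y))
            (ℚ.+-monoʳ-≤ (Y *ᑫ Y) (ℚ.neg-antimono-≤ (square-nonNeg H)))))
        (subst (Y *ᑫ Y ≤ᑫ_)
          (solve 1 (λ t → t :* t := con ½ :* t :* (t :+ t)) refl t)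
          (*-mono (*-nonNeg 0≤y (+-nonNeg (ℚ.<⇒≤ 0<t) 0≤h)) (ℚ.<⇒≤ 0<t) y[t+h]≤t y[t+h]≤t)))
      where
      Y H : ℚ
      Y = y *ᑫ (t +ᑫ h)
      H = y *ᑫ h

    dyadic-decay : ∀ {r} → 0ℚ ≤ᑫ r → r <ᑫ 1ℚ → ∀ m →
                   ∃ λ N → r ^ᑫ N *ᑫ (2^- m +ᑫ (1ℚ -ᑫ r)) ≤ᑫ 2^- m
    -- With h = 1 - r this is r (1 + h) = 1 - h² ≤ 1.
    dyadic-decay {r} 0≤r r<1 zero = 1 , subst₂ _≤ᑫ_
      (solve 1 (λ r → con 1ℚ :- (con 1ℚ :- r) :* (con 1ℚ :- r) :=
        (r :* con 1ℚ) :* (con 1ℚ :+ (con 1ℚ :- r))) refl r)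
      (ℚ.+-identityʳ 1ℚ)
      (ℚ.+-monoʳ-≤ 1ℚ (ℚ.neg-antimono-≤ (square-nonNeg (1ℚ -ᑫ r))))
    dyadic-decay {r} 0≤r r<1 (suc m) =
      let N , ≤2^- = dyadic-decay 0≤r r<1 m
      in N + N , subst (λ y → y *ᑫ (2^- suc m +ᑫ (1ℚ -ᑫ r)) ≤ᑫ 2^- suc m)
           (sym (^ᑫ.^-homo-* r N N))
           (square-step (^ᑫ-nonNeg 0≤r N) (2^-pos m) (ℚ.<⇒≤ (0<1- r<1)) ≤2^-)

  ^ᑫ→0 : ∀ {r} → 0ℚ ≤ᑫ r → r <ᑫ 1ℚ → ∀ {ε} → 0ℚ <ᑫ ε →
         ∃ λ N → ∀ {n} → N ℕ.≤ n → r ^ᑫ n ≤ᑫ ε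
  ^ᑫ→0 {r} 0≤r r<1 {ε} 0<ε =
    let h = 1ℚ -ᑫ r
        0<h = 0<1- r<1
        -- Dropping 2^-m from the sum in `dyadic-decay` leaves r^N h ≤ 2^-m, so 2^-m < ε h is what
        -- is needed to cancel h.
        m , 2^-< = 2^-→0 (*-pos 0<ε 0<h)
        N , ≤2^- = dyadic-decay 0≤r r<1 m
    in N , λ {n} N≤n → ℚ.≤-trans (^ᑫ-antimono 0≤r (ℚ.<⇒≤ r<1) N≤n)
      (ℚ.*-cancelʳ-≤-pos h {{ℚ.positive 0<h}}
        (ℚ.≤-trans
          (ℚ.*-monoˡ-≤-nonNeg (r ^ᑫ N) {{ℚ.nonNegative (^ᑫ-nonNeg 0≤r N)}}
            (subst (h ≤ᑫ_) (ℚ.+-comm h (2^- m)) (≤-+-nonNeg (ℚ.<⇒≤ (2^-pos m)))))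
          (ℚ.≤-trans ≤2^- (ℚ.<⇒≤ (2^-< ℕ.≤-refl)))))

  scaled-^ᑫ→0 : ∀ {r B} → 0ℚ ≤ᑫ r → r <ᑫ 1ℚ → 0ℚ ≤ᑫ B → ∀ {ε} → 0ℚ <ᑫ ε →
                ∃ λ N → ∀ {n} → N ℕ.≤ n → B *ᑫ r ^ᑫ n ≤ᑫ ε
  scaled-^ᑫ→0 {r} {B} 0≤r r<1 0≤B {ε} 0<ε =
    -- `B` may be 0, so `ε` is divided by `B + 1`.
    let 0<B+1 = ℚ.+-mono-≤-< 0≤B 0<1
        δ , 0<δ , [B+1]δ≡ε = split 0<B+1 0<ε
        N , r^≤δ = ^ᑫ→0 0≤r r<1 0<δ
    in N , λ {n} N≤n → subst (B *ᑫ r ^ᑫ n ≤ᑫ_) [B+1]δ≡ε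
      (*-mono 0≤B (ℚ.<⇒≤ 0<δ) (≤-+-nonNeg (ℚ.<⇒≤ 0<1)) (r^≤δ N≤n))

  -- Induction on the threshold, shifting the sequence by one: the constant grows to `a 0 + C/θ`,
  -- where the division by `θ` pays for the shift and `a 0` covers the term set aside.
  eventual-ratio⇒geometric :
    ∀ {θ} → 0ℚ <ᑫ θ → ∀ N (a : ℕ → ℚ) → (∀ n → 0ℚ ≤ᑫ a n) →
    (∀ n → N ℕ.≤ n → a (suc n) ≤ᑫ θ *ᑫ a n) →
    ∃ λ C → 0ℚ ≤ᑫ C × ∀ n → a n ≤ᑫ C *ᑫ θ ^ᑫ n
  eventual-ratio⇒geometric {θ} 0<θ zero a 0≤a step = a 0 , 0≤a 0 , bound
    where
    bound : ∀ n → a n ≤ᑫ a 0 *ᑫ θ ^ᑫ n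
    bound zero    = ℚ.≤-reflexive (sym (ℚ.*-identityʳ (a 0)))
    bound (suc n) = ℚ.≤-trans (step n ℕ.z≤n) (subst (θ *ᑫ a n ≤ᑫ_)
      (solve 3 (λ θ a x → θ :* (a :* x) := a :* (θ :* x)) refl θ (a 0) (θ ^ᑫ n))
      (ℚ.*-monoˡ-≤-nonNeg θ {{ℚ.nonNegative (ℚ.<⇒≤ 0<θ)}} (bound n)))
  eventual-ratio⇒geometric {θ} 0<θ (suc N) a 0≤a step =
    let C , 0≤C , a≤ = eventual-ratio⇒geometric 0<θ N (a ∘ suc) (0≤a ∘ suc)
                         (λ n N≤n → step (suc n) (ℕ.s≤s N≤n))
        C/θ = C *ᑫ recip θ
        0≤C/θ = *-nonNeg 0≤C (ℚ.<⇒≤ (recip-pos 0<θ))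
        0≤a0 = 0≤a 0
    in a 0 +ᑫ C/θ , +-nonNeg 0≤a0 0≤C/θ , λ
      { zero    → subst (a 0 ≤ᑫ_) (sym (ℚ.*-identityʳ (a 0 +ᑫ C/θ))) (≤-+-nonNeg 0≤C/θ)
      ; (suc n) → ℚ.≤-trans (a≤ n) (subst₂ _≤ᑫ_
          (trans (solve 4 (λ C i θ x → (C :* i) :* (θ :* x) := (θ :* i) :* (C :* x))
              refl C (recip θ) θ (θ ^ᑫ n))
            (trans (cong (_*ᑫ (C *ᑫ θ ^ᑫ n)) (*-recip 0<θ)) (ℚ.*-identityˡ (C *ᑫ θ ^ᑫ n))))
          (cong (_*ᑫ θ ^ᑫ suc n) (ℚ.+-comm C/θ (a 0)))
          (ℚ.*-monoʳ-≤-nonNeg (θ ^ᑫ suc n) {{ℚ.nonNegative (^ᑫ-nonNeg (ℚ.<⇒≤ 0<θ) (suc n))}}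
            (≤-+-nonNeg {C/θ} 0≤a0)))
      }

-- Finite sums

abstract

  ∑ᵍ<-cong : ∀ n {f g : ℕ → ℚ[i]} → (∀ i → i ℕ.< n → f i ≡ g i) → ∑ᵍ< n f ≡ ∑ᵍ< n g
  ∑ᵍ<-cong zero    f≗g = refl
  ∑ᵍ<-cong (suc n) f≗g = cong₂ _+ᵍ_ (f≗g 0 ℕ.z<s) (∑ᵍ<-cong n (λ i i<n → f≗g (suc i) (ℕ.s<s i<n)))

  ∑ᵍ<-+ : ∀ m n f → ∑ᵍ< (m + n) f ≡ ∑ᵍ< m f +ᵍ ∑ᵍ< n (λ i → f (m + i))
  ∑ᵍ<-+ zero    n f = sym (ℚᵢ.+-identityˡ (∑ᵍ< n f))
  ∑ᵍ<-+ (suc m) n f = trans (cong (f 0 +ᵍ_) (∑ᵍ<-+ m n (f ∘ suc)))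
    (sym (ℚᵢ.+-assoc (f 0) (∑ᵍ< m (f ∘ suc)) (∑ᵍ< n (λ i → f (suc m + i)))))

  ∑ᵍ<-suc : ∀ n f → ∑ᵍ< (suc n) f ≡ ∑ᵍ< n f +ᵍ f n
  ∑ᵍ<-suc n f = begin
    ∑ᵍ< (suc n) f                ≡⟨ cong (λ m → ∑ᵍ< m f) (ℕ.+-comm 1 n) ⟩
    ∑ᵍ< (n + 1) f                ≡⟨ ∑ᵍ<-+ n 1 f ⟩
    ∑ᵍ< n f +ᵍ (f (n + 0) +ᵍ 0ᵍ) ≡⟨ cong (∑ᵍ< n f +ᵍ_) (ℚᵢ.+-identityʳ (f (n + 0))) ⟩
    ∑ᵍ< n f +ᵍ f (n + 0)         ≡⟨ cong (λ m → ∑ᵍ< n f +ᵍ f m) (ℕ.+-identityʳ n) ⟩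
    ∑ᵍ< n f +ᵍ f n               ∎
    where open ≡-Reasoning

-- The multiple n b, written as an iterated sum so that n need not be embedded in `ℚ`.
∑ᑫ< : ℕ → ℚ → ℚ
∑ᑫ< zero    b = 0ℚ
∑ᑫ< (suc n) b = b +ᑫ ∑ᑫ< n b

abstract

  ∑ᑫ<-nonNeg : ∀ n {b} → 0ℚ ≤ᑫ b → 0ℚ ≤ᑫ ∑ᑫ< n b
  ∑ᑫ<-nonNeg zero    0≤b = ℚ.≤-refl
  ∑ᑫ<-nonNeg (suc n) 0≤b = +-nonNeg 0≤b (∑ᑫ<-nonNeg n 0≤b)

  ∑ᵍ<-≼ : ∀ n {f : ℕ → ℚ[i]} {b c} → 0ℚ ≤ᑫ c → (∀ i → i ℕ.< n → f i ≼ b *ᑫ c) →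
          ∑ᵍ< n f ≼ ∑ᑫ< n b *ᑫ c
  ∑ᵍ<-≼ zero    {c = c} 0≤c f≼ = 0ᵍ-≼ (ℚ.≤-reflexive (sym (ℚ.*-zeroˡ c)))
  ∑ᵍ<-≼ (suc n) {f} {b} {c} 0≤c f≼ = subst (∑ᵍ< (suc n) f ≼_)
    (sym (ℚ.*-distribʳ-+ c b (∑ᑫ< n b)))
    (+ᵍ-≼ (f≼ 0 ℕ.z<s) (∑ᵍ<-≼ n 0≤c (λ i i<n → f≼ (suc i) (ℕ.s<s i<n))))

  -- `σ` is 1 / (1 - θ), entering through its fixed-point equation: the first term costs b, the
  -- others b θ σ, and together they cost b σ whatever the length of the sum.
  ∑ᵍ<-geometric-≼ : ∀ {θ σ} → 0ℚ ≤ᑫ θ → 0ℚ ≤ᑫ σ → 1ℚ +ᑫ θ *ᑫ σ ≡ σ →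
    ∀ n {f : ℕ → ℚ[i]} {b} → 0ℚ ≤ᑫ b → (∀ i → f i ≼ b *ᑫ θ ^ᑫ i) → ∑ᵍ< n f ≼ b *ᑫ σ
  ∑ᵍ<-geometric-≼ 0≤θ 0≤σ eq zero    0≤b f≼ = 0ᵍ-≼ (*-nonNeg 0≤b 0≤σ)
  ∑ᵍ<-geometric-≼ {θ} {σ} 0≤θ 0≤σ eq (suc n) {f} {b} 0≤b f≼ = subst (∑ᵍ< (suc n) f ≼_)
    (trans (solve 3 (λ b θ σ → b :* con 1ℚ :+ (b :* θ) :* σ := b :* (con 1ℚ :+ θ :* σ))
        refl b θ σ)
      (cong (b *ᑫ_) eq))
    (+ᵍ-≼ (f≼ 0) (∑ᵍ<-geometric-≼ 0≤θ 0≤σ eq n (*-nonNeg 0≤b 0≤θ)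
      (λ i → subst (f (suc i) ≼_) (sym (ℚ.*-assoc b θ (θ ^ᑫ i))) (f≼ (suc i)))))

-- Termwise evaluation of complex numbers

-- The operations of `ℚ[i]` repeat the formulas of the complex ones literally, `invᵍ` those of
-- division, so `ev` commutes with them definitionally; induction is left only for powers, sums and
-- products.
ev : ℂ → ℕ → ℚ[i]
ev w n = mkℚ[i] (seq (re w) n) (seq (im w) n)

abstract

  ev-^ : ∀ w i n → ev (w ^ i) n ≡ ev w n ^ᵍ i
  ev-^ w zero    n = refl
  ev-^ w (suc i) n = cong (ev w n *ᵍ_) (ev-^ w i n)

  ev-∑< : ∀ m f n → ev (∑< m f) n ≡ ∑ᵍ< m (λ i → ev (f i) n)
  ev-∑< zero    f n = refl
  ev-∑< (suc m) f n = cong (ev (f 0) n +ᵍ_) (ev-∑< m (f ∘ suc) n)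

  ev-bounded : ∀ w → ∃ λ K → 0ℚ ≤ᑫ K × ∃ λ N → ∀ n → N ℕ.≤ n → ev w n ≼ K
  ev-bounded w =
    let A , 0<A , M , ≤A = bounded (re w)
        B , 0<B , N , ≤B = bounded (im w)
        0≤A = ℚ.<⇒≤ 0<A
        0≤B = ℚ.<⇒≤ 0<B
        0≤AB = *-nonNeg 0≤A 0≤B
    in A +ᑫ B , +-nonNeg 0≤A 0≤B , M ℕ.⊔ N , λ n ≤n →
      mk≼ (+-nonNeg 0≤A 0≤B) (ℚ.≤-trans
        (ℚ.+-mono-≤ (square-≤ 0≤A (≤A (ℕ.m⊔n≤o⇒m≤o M N ≤n)))
                    (square-≤ 0≤B (≤B (ℕ.m⊔n≤o⇒n≤o M N ≤n))))
        (subst (A *ᑫ A +ᑫ B *ᑫ B ≤ᑫ_)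
          (solve 2 (λ A B → A :* A :+ B :* B :+ (A :* B :+ A :* B) := (A :+ B) :* (A :+ B))
            refl A B)
          (≤-+-nonNeg (+-nonNeg 0≤AB 0≤AB))))
    where
    square-≤ : ∀ {p A} → 0ℚ ≤ᑫ A → ∣ p ∣ᑫ ≤ᑫ A → p *ᑫ p ≤ᑫ A *ᑫ A
    square-≤ {p} 0≤A ∣p∣≤A = subst (_≤ᑫ _) (∣-∣-square p) (*-mono (ℚ.0≤∣p∣ p) 0≤A ∣p∣≤A ∣p∣≤A)

  ev-<1 : ∀ q → ∣ q ∣ <ʳ 1ʳ →
          ∃ λ r → 0ℚ ≤ᑫ r × r <ᑫ 1ℚ × ∃ λ N → ∀ n → N ℕ.≤ n → ev q n ≼ r
  ev-<1 q ∣q∣<1 =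
    let δ , 0<δ , N , Nq+δ≤1 = √<1⇒<1 (normSq q) ∣q∣<1
        0≤½δ = ℚ.<⇒≤ (half-pos 0<δ)
        δ≤1 = ℚ.≤-trans (subst (_≤ᑫ seq (normSq q) N +ᑫ δ) (ℚ.+-identityˡ δ)
                (ℚ.+-monoˡ-≤ δ (normSqᵍ-nonNeg (ev q N)))) (Nq+δ≤1 ℕ.≤-refl)
        -- A rational bound on the modulus without a root: (1 - δ/2)² exceeds 1 - δ by a square.
        r = 1ℚ -ᑫ ½ *ᑫ δ
        0≤r = subst (_≤ᑫ r) (ℚ.+-inverseʳ (½ *ᑫ δ)) (ℚ.+-monoˡ-≤ (-ᑫ (½ *ᑫ δ))
                (ℚ.≤-trans (half-≤ (ℚ.<⇒≤ 0<δ)) δ≤1))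
    in r , 0≤r
     , subst (r <ᑫ_) (ℚ.+-identityʳ 1ℚ) (ℚ.+-monoʳ-< 1ℚ (ℚ.neg-antimono-< (half-pos 0<δ)))
     , N , λ n N≤n → mk≼ 0≤r (ℚ.≤-trans
         (subst₂ _≤ᑫ_
           (solve 2 (λ x d → (x :+ d) :- d := x) refl (seq (normSq q) n) δ) refl
           (ℚ.+-monoˡ-≤ (-ᑫ δ) (Nq+δ≤1 N≤n)))
         (subst (1ℚ -ᑫ δ ≤ᑫ_)
           (solve 1 (λ d → (con 1ℚ :- d) :+ (con ½ :* d) :* (con ½ :* d) :=
                           (con 1ℚ :- con ½ :* d) :* (con 1ℚ :- con ½ :* d)) refl δ)
           (≤-+-nonNeg (square-nonNeg (½ *ᑫ δ)))))

  -- The threshold on the index n may depend on m, because `<ʳ` compares two sequences only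
  -- eventually.
  ev⇒⟶ : ∀ u w → (∀ {ε} → 0ℚ <ᑫ ε → ∃ λ M → ∀ m → M ℕ.≤ m → ∃ λ N → ∀ n → N ℕ.≤ n →
                    ev (u m) n -ᵍ ev w n ≼ ε) → u ⟶ w
  ev⇒⟶ u w close ε (δ , 0<δ , N₁ , δ≤ε) =
    -- The difference is kept below δ/4; the inexact square root doubles this to δ/2, and the other
    -- half of δ remains as the gap that `<ʳ` demands.
    let 0<½δ = half-pos 0<δ
        0<¼δ = half-pos 0<½δ
        M , closeₘ = close 0<¼δ
    in M , λ m M≤m →
      let v = u m -ᶜ w
          N₂ , closeₙ = closeₘ m M≤m
          N₃ , squareₙ = sqrtSeq-square (normSq v) (*-pos 0<¼δ 0<¼δ)
      in ½ *ᑫ δ , 0<½δ , N₁ ℕ.⊔ (N₂ ℕ.⊔ N₃) , λ {n} ≤n →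
        let ≤n′ = ℕ.m⊔n≤o⇒n≤o N₁ (N₂ ℕ.⊔ N₃) ≤n
        in ℚ.≤-trans
          (ℚ.+-monoˡ-≤ (½ *ᑫ δ) (subst (seq ∣ v ∣ n ≤ᑫ_) (half+half (½ *ᑫ δ))
            (sqrt-≤ v n (closeₙ n (ℕ.m⊔n≤o⇒m≤o N₂ N₃ ≤n′))
              (ℚ.<⇒≤ (squareₙ (ℕ.m⊔n≤o⇒n≤o N₂ N₃ ≤n′))))))
          (subst (_≤ᑫ seq ε n) (trans (ℚ.+-identityˡ δ) (sym (half+half δ)))
            (δ≤ε (ℕ.m⊔n≤o⇒m≤o N₁ (N₂ ℕ.⊔ N₃) ≤n)))
    where
    -- `sqrtSeq` squares to the norm only approximately; an error of at most b² gives s² ≤ 2b² ≤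
    -- (2b)².
    sqrt-≤ : ∀ v n {b} → ev v n ≼ b →
             ∣ sqrtSeq (normSq v) n *ᑫ sqrtSeq (normSq v) n -ᑫ (seq (normSq v) n ℚ.⊔ 0ℚ) ∣ᑫ ≤ᑫ b *ᑫ b →
             seq ∣ v ∣ n ≤ᑫ b +ᑫ b
    sqrt-≤ v n {b} (mk≼ 0≤b Nv≤) sq≤ = square-cancel-≤ (+-nonNeg 0≤b 0≤b) (ℚ.≤-trans
      (subst₂ _≤ᑫ_ (solve 2 (λ s p → (s :- p) :+ p := s) refl (s *ᑫ s) p) refl
        (ℚ.+-mono-≤ (ℚ.≤-trans (≤-∣-∣ (s *ᑫ s -ᑫ p)) sq≤)
                    (ℚ.⊔-lub Nv≤ (*-nonNeg 0≤b 0≤b))))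
      (subst (b *ᑫ b +ᑫ b *ᑫ b ≤ᑫ_)
        (solve 1 (λ b → b :* b :+ b :* b :+ (b :* b :+ b :* b) := (b :+ b) :* (b :+ b)) refl b)
        (≤-+-nonNeg (+-nonNeg (square-nonNeg b) (square-nonNeg b)))))
      where
      s p : ℚ
      s = sqrtSeq (normSq v) n
      p = seq (normSq v) n ℚ.⊔ 0ℚ

-- The sum of a series of complex numbers is the diagonal of its partial sums: a
-- bound on the tails that is uniform in the index of the approximating sequences
-- makes that diagonal a Cauchy sequence.
module _ (u : ℕ → ℂ) {B θ} (0≤B : 0ℚ ≤ᑫ B) (0≤θ : 0ℚ ≤ᑫ θ) (θ<1 : θ <ᑫ 1ℚ) (N₀ : ℕ)
         (close : ∀ M m n → N₀ ℕ.≤ n → M ℕ.≤ m → ev (u m) n -ᵍ ev (u M) n ≼ B *ᑫ θ ^ᑫ M) where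

  abstract

    private

      diagonal-cauchy : (part : ℂ → ℝ) →
        (∀ w v n {b} → ev w n -ᵍ ev v n ≼ b → ∣ seq (part w) n -ᑫ seq (part v) n ∣ᑫ ≤ᑫ b) →
        Cauchy (λ n → seq (part (u n)) n)
      diagonal-cauchy part part-≼ {ε} 0<ε =
        -- Both diagonal entries are compared with the fixed `u M`, at a cost of ε/4 each; the
        -- Cauchy property of `u M` covers the change of index with ε/2.
        let 0<¼ε = half-pos (half-pos 0<ε)
            M , θ^≤ = scaled-^ᑫ→0 0≤θ θ<1 0≤B 0<¼ε
            N , close-u = cauchy (part (u M)) (half-pos 0<ε)
            x = λ m n → seq (part (u m)) n
            near = λ {n} (≤n : N₀ ℕ.⊔ M ℕ.≤ n) → ℚ.≤-trans
              (part-≼ (u n) (u M) n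
                (close M n n (ℕ.m⊔n≤o⇒m≤o N₀ M ≤n) (ℕ.m⊔n≤o⇒n≤o N₀ M ≤n)))
              (θ^≤ ℕ.≤-refl)
        in (N₀ ℕ.⊔ M) ℕ.⊔ N , λ {m} {n} ≤m ≤n →
          ℚ.≤-<-trans (∣-∣-triangle (x m m) (x M m) (x n n))
            (ℚ.≤-<-trans (ℚ.+-monoʳ-≤ ∣ x m m -ᑫ x M m ∣ᑫ (∣-∣-triangle (x M m) (x M n) (x n n)))
              (subst (∣ x m m -ᑫ x M m ∣ᑫ +ᑫ (∣ x M m -ᑫ x M n ∣ᑫ +ᑫ ∣ x M n -ᑫ x n n ∣ᑫ) <ᑫ_)
                (solve 1 (λ e → con ½ :* (con ½ :* e) :+ (con ½ :* e :+ con ½ :* (con ½ :* e)) := e)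
                  refl ε)
                (ℚ.+-mono-≤-< (near (ℕ.m⊔n≤o⇒m≤o (N₀ ℕ.⊔ M) N ≤m))
                  (ℚ.+-mono-<-≤
                    (close-u (ℕ.m⊔n≤o⇒n≤o (N₀ ℕ.⊔ M) N ≤m) (ℕ.m⊔n≤o⇒n≤o (N₀ ℕ.⊔ M) N ≤n))
                    (subst (_≤ᑫ ½ *ᑫ (½ *ᑫ ε)) (∣-∣-sym (x n n) (x M n))
                      (near (ℕ.m⊔n≤o⇒m≤o (N₀ ℕ.⊔ M) N ≤n)))))))

  diagonal : ℂ
  diagonal = mkℂ (mkℝ (λ n → seq (re (u n)) n) (diagonal-cauchy re (λ _ _ _ → ∣reᵍ∣≤)))
                 (mkℝ (λ n → seq (im (u n)) n) (diagonal-cauchy im (λ _ _ _ → ∣imᵍ∣≤)))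

  abstract

    ⟶-diagonal : u ⟶ diagonal
    ⟶-diagonal = ev⇒⟶ u diagonal λ 0<ε →
      let M , θ^≤ = scaled-^ᑫ→0 0≤θ θ<1 0≤B 0<ε
      in M , λ m M≤m → N₀ ℕ.⊔ m , λ n ≤n → subst (_≼ _)
        (solveᵍ 2 (λ x y → ⊝ (x ⊖ y) ⊜ y ⊖ x) refl (ev (u n) n) (ev (u m) n))
        (-ᵍ-≼ (≼-weaken (close m n n (ℕ.m⊔n≤o⇒m≤o N₀ m ≤n) (ℕ.m⊔n≤o⇒n≤o N₀ m ≤n)) (θ^≤ M≤m)))

-- The lattice path identity

triangular : ℕ → ℕ
triangular zero    = 0
triangular (suc s) = suc s + triangular s

module Path (q z : ℚ[i]) where

  poch : ℚ[i] → ℕ → ℚ[i]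
  poch a zero    = 1ᵍ
  poch a (suc n) = poch a n *ᵍ (1ᵍ -ᵍ a *ᵍ q ^ᵍ n)

  1/[q] : ℕ → ℚ[i]
  1/[q] zero    = 1ᵍ
  1/[q] (suc s) = 1/[q] s *ᵍ invᵍ (1ᵍ -ᵍ q ^ᵍ suc s)

  -- Expanding (-zq;q)_∞ as the generating function of partitions λ into distinct
  -- parts, F n s counts the λ with s parts exceeding n, and G n s those λ having
  -- n + 1 as a part together with s parts exceeding n + 1.
  F G : ℕ → ℕ → ℚ[i]
  F n s = poch (-ᵍ z *ᵍ q) n *ᵍ 1/[q] s *ᵍ z ^ᵍ s *ᵍ q ^ᵍ (s * n + triangular s)
  G n s = poch (-ᵍ z *ᵍ q) n *ᵍ 1/[q] s *ᵍ z ^ᵍ suc s *ᵍ q ^ᵍ (suc s * suc n + triangular s)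

  D : ℕ → ℕ → ℚ[i]
  D n zero    = F n 0
  D n (suc s) = D n s +ᵍ F n (suc s)

  abstract

    -- `product` peels off the first factor, while `poch` appends the last one, as a step in n
    -- requires; this converts between them. The inner `1ᵍ` is `q ^ᵍ 0`.
    poch-shift : ∀ a n → poch a (suc n) ≡ (1ᵍ -ᵍ a *ᵍ 1ᵍ) *ᵍ poch (a *ᵍ q) n
    poch-shift a zero    = ℚᵢ.*-comm 1ᵍ (1ᵍ -ᵍ a *ᵍ 1ᵍ)
    poch-shift a (suc n) = trans
      (cong (_*ᵍ (1ᵍ -ᵍ a *ᵍ (q *ᵍ q ^ᵍ n))) (poch-shift a n))
      (solveᵍ 5 (λ x p a q y → (x ⊗ p) ⊗ (conᵍ 1ᵍ ⊖ a ⊗ (q ⊗ y)) ⊜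
                               x ⊗ (p ⊗ (conᵍ 1ᵍ ⊖ (a ⊗ q) ⊗ y)))
        refl (1ᵍ -ᵍ a *ᵍ 1ᵍ) (poch (a *ᵍ q) n) a q (q ^ᵍ n))

    F-zero : ∀ n → F n 0 ≡ poch (-ᵍ z *ᵍ q) n
    F-zero n = solveᵍ 1 (λ p → p ⊗ conᵍ 1ᵍ ⊗ conᵍ 1ᵍ ⊗ conᵍ 1ᵍ ⊜ p) refl (poch (-ᵍ z *ᵍ q) n)

    -- The sum runs from the top down, to match the exponents ℓm - i of the first series.
    D-vertical : ∀ n s b → D n (s + b) ≡ D n s +ᵍ ∑ᵍ< b (λ i → F n (s + b ∸ i))
    D-vertical n s zero    = trans (cong (D n) (ℕ.+-identityʳ s)) (sym (ℚᵢ.+-identityʳ (D n s)))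
    D-vertical n s (suc b) rewrite ℕ.+-suc s b = trans
      (cong (_+ᵍ F n (suc (s + b))) (D-vertical n s b))
      (solveᵍ 3 (λ d x y → (d ⊕ x) ⊕ y ⊜ d ⊕ (y ⊕ x)) refl
        (D n s) (∑ᵍ< b (λ i → F n (s + b ∸ i))) (F n (suc (s + b))))

  -- A single rational approximation of q may make a denominator vanish, so invertibility is assumed
  -- here and supplied by the estimates.
  module _ (units : ∀ s → (1ᵍ -ᵍ q ^ᵍ suc s) *ᵍ invᵍ (1ᵍ -ᵍ q ^ᵍ suc s) ≡ 1ᵍ) where

    abstract

      poch-*-1/[q] : ∀ s → poch q s *ᵍ 1/[q] s ≡ 1ᵍ
      poch-*-1/[q] zero    = ℚᵢ.*-identityˡ 1ᵍ
      poch-*-1/[q] (suc s) = trans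
        (solveᵍ 4 (λ p e i j → (p ⊗ e) ⊗ (i ⊗ j) ⊜ (p ⊗ i) ⊗ (e ⊗ j)) refl
          (poch q s) e (1/[q] s) (invᵍ e))
        (trans (cong₂ _*ᵍ_ (poch-*-1/[q] s) (units s)) (ℚᵢ.*-identityˡ 1ᵍ))
        where
        e : ℚ[i]
        e = 1ᵍ -ᵍ q ^ᵍ suc s

      1/[q]-suc : ∀ s → 1/[q] s ≡ 1/[q] (suc s) *ᵍ (1ᵍ -ᵍ q ^ᵍ suc s)
      1/[q]-suc s = sym (trans
        (solveᵍ 3 (λ i e j → (i ⊗ j) ⊗ e ⊜ i ⊗ (e ⊗ j)) refl (1/[q] s) e (invᵍ e))
        (trans (cong (1/[q] s *ᵍ_) (units s)) (ℚᵢ.*-identityʳ (1/[q] s))))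
        where
        e : ℚ[i]
        e = 1ᵍ -ᵍ q ^ᵍ suc s

      F-step-zero : ∀ n → F (suc n) 0 ≡ F n 0 +ᵍ G n 0
      F-step-zero n = trans (F-zero (suc n)) (trans
        (solveᵍ 4 (λ p z q x → p ⊗ (conᵍ 1ᵍ ⊖ (⊝ z ⊗ q) ⊗ x) ⊜
          p ⊕ p ⊗ conᵍ 1ᵍ ⊗ (z ⊗ conᵍ 1ᵍ) ⊗ (q ⊗ x)) refl (poch (-ᵍ z *ᵍ q) n) z q (q ^ᵍ n))
        (cong₂ _+ᵍ_ (sym (F-zero n))
          (cong (λ e → poch (-ᵍ z *ᵍ q) n *ᵍ 1ᵍ *ᵍ (z *ᵍ 1ᵍ) *ᵍ q ^ᵍ e)
            (sym (trans (ℕ.+-identityʳ (1 * suc n)) (ℕ.*-identityˡ (suc n)))))))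

      -- F (n + 1) (s + 1) and F n (s + 1) count the same λ without a part n + 1; those
      -- with that part are counted by G n (s + 1) and G n s respectively.
      F-step : ∀ n s → F (suc n) (suc s) +ᵍ G n s ≡ F n (suc s) +ᵍ G n (suc s)
      F-step n s = begin
        F (suc n) (suc s) +ᵍ G n s
          ≡⟨ cong₂ _+ᵍ_ (cong (λ x → pₙ *ᵍ (1ᵍ -ᵍ -ᵍ z *ᵍ q *ᵍ qⁿ) *ᵍ ι *ᵍ (z *ᵍ zˢ) *ᵍ x) exponent₁)
                        (cong₂ (λ j x → pₙ *ᵍ j *ᵍ (z *ᵍ zˢ) *ᵍ x) (1/[q]-suc s) exponent₂) ⟩
        pₙ *ᵍ (1ᵍ -ᵍ -ᵍ z *ᵍ q *ᵍ qⁿ) *ᵍ ι *ᵍ (z *ᵍ zˢ) *ᵍ (a *ᵍ (q *ᵍ qˢ)) +ᵍ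
        pₙ *ᵍ (ι *ᵍ (1ᵍ -ᵍ q *ᵍ qˢ)) *ᵍ (z *ᵍ zˢ) *ᵍ a
          -- Over the common denominator (q;q)_{s+1}, the two terms in z^{s+1} that carry the extra
          -- factor q^{s+1} cancel.
          ≡⟨ solveᵍ 8 (λ p ι z zˢ a q qˢ qⁿ →
               p ⊗ (conᵍ 1ᵍ ⊖ ⊝ z ⊗ q ⊗ qⁿ) ⊗ ι ⊗ (z ⊗ zˢ) ⊗ (a ⊗ (q ⊗ qˢ)) ⊕
               p ⊗ (ι ⊗ (conᵍ 1ᵍ ⊖ q ⊗ qˢ)) ⊗ (z ⊗ zˢ) ⊗ a ⊜
               p ⊗ ι ⊗ (z ⊗ zˢ) ⊗ a ⊕
               p ⊗ ι ⊗ (z ⊗ (z ⊗ zˢ)) ⊗ (a ⊗ (q ⊗ qˢ) ⊗ (q ⊗ qⁿ)))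
               refl pₙ ι z zˢ a q qˢ qⁿ ⟩
        pₙ *ᵍ ι *ᵍ (z *ᵍ zˢ) *ᵍ a +ᵍ
        pₙ *ᵍ ι *ᵍ (z *ᵍ (z *ᵍ zˢ)) *ᵍ (a *ᵍ (q *ᵍ qˢ) *ᵍ (q *ᵍ qⁿ))
          ≡⟨ cong (λ x → pₙ *ᵍ ι *ᵍ (z *ᵍ zˢ) *ᵍ a +ᵍ pₙ *ᵍ ι *ᵍ (z *ᵍ (z *ᵍ zˢ)) *ᵍ x) exponent₃ ⟨
        F n (suc s) +ᵍ G n (suc s) ∎
        where
        open ≡-Reasoning
        E : ℕ
        E = suc s * n + triangular (suc s)
        pₙ ι zˢ a qˢ qⁿ : ℚ[i]
        pₙ = poch (-ᵍ z *ᵍ q) n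
        ι  = 1/[q] (suc s)
        zˢ = z ^ᵍ s
        a  = q ^ᵍ E
        qˢ = q ^ᵍ s
        qⁿ = q ^ᵍ n
        exponent₁ : q ^ᵍ (suc s * suc n + triangular (suc s)) ≡ a *ᵍ (q *ᵍ qˢ)
        exponent₁ = trans (cong (q ^ᵍ_) (ℕ-solve 3 (λ n s t →
            (con′ 1 ⊞ s) ⊠ (con′ 1 ⊞ n) ⊞ t ≐ ((con′ 1 ⊞ s) ⊠ n ⊞ t) ⊞ (con′ 1 ⊞ s))
            refl n s (triangular (suc s))))
          (^ᵍ.^-homo-* q E (suc s))
        exponent₂ : q ^ᵍ (suc s * suc n + triangular s) ≡ a
        exponent₂ = cong (q ^ᵍ_) (ℕ-solve 3 (λ n s t →
            (con′ 1 ⊞ s) ⊠ (con′ 1 ⊞ n) ⊞ t ≐ (con′ 1 ⊞ s) ⊠ n ⊞ (con′ 1 ⊞ s ⊞ t))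
            refl n s (triangular s))
        exponent₃ : q ^ᵍ (suc (suc s) * suc n + triangular (suc s)) ≡ a *ᵍ (q *ᵍ qˢ) *ᵍ (q *ᵍ qⁿ)
        exponent₃ = trans (cong (q ^ᵍ_) (ℕ-solve 3 (λ n s t →
            (con′ 2 ⊞ s) ⊠ (con′ 1 ⊞ n) ⊞ t ≐
            ((con′ 1 ⊞ s) ⊠ n ⊞ t) ⊞ (con′ 1 ⊞ s) ⊞ (con′ 1 ⊞ n))
            refl n s (triangular (suc s))))
          (trans (^ᵍ.^-homo-* q (E + suc s) (suc n))
            (cong (_*ᵍ (q *ᵍ qⁿ)) (^ᵍ.^-homo-* q E (suc s))))

      -- `F-step` telescopes along s: raising s by one exchanges the correction `G n s` for
      -- `G n (suc s)`.
      D-step : ∀ n s → D (suc n) s ≡ D n s +ᵍ G n s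
      D-step n zero    = F-step-zero n
      D-step n (suc s) = begin
        D (suc n) s +ᵍ F (suc n) (suc s)
          ≡⟨ cong (_+ᵍ F (suc n) (suc s)) (D-step n s) ⟩
        D n s +ᵍ G n s +ᵍ F (suc n) (suc s)
          ≡⟨ solveᵍ 3 (λ d g f → d ⊕ g ⊕ f ⊜ d ⊕ (f ⊕ g)) refl (D n s) (G n s) (F (suc n) (suc s)) ⟩
        D n s +ᵍ (F (suc n) (suc s) +ᵍ G n s)
          ≡⟨ cong (D n s +ᵍ_) (F-step n s) ⟩
        D n s +ᵍ (F n (suc s) +ᵍ G n (suc s))
          ≡⟨ ℚᵢ.+-assoc (D n s) (F n (suc s)) (G n (suc s)) ⟨
        D n (suc s) +ᵍ G n (suc s) ∎
        where open ≡-Reasoning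

      D-horizontal : ∀ n s b → D (n + b) s ≡ D n s +ᵍ ∑ᵍ< b (λ j → G (n + b ∸ j ∸ 1) s)
      D-horizontal n s zero    =
        trans (cong (λ n → D n s) (ℕ.+-identityʳ n)) (sym (ℚᵢ.+-identityʳ (D n s)))
      D-horizontal n s (suc b) rewrite ℕ.+-suc n b = trans
        (D-step (n + b) s)
        (trans (cong (_+ᵍ G (n + b) s) (D-horizontal n s b))
          (solveᵍ 3 (λ d x y → (d ⊕ x) ⊕ y ⊜ d ⊕ (y ⊕ x)) refl
            (D n s) (∑ᵍ< b (λ j → G (n + b ∸ j ∸ 1) s)) (G (n + b) s)))

      -- Each stair goes in n first, at height ℓM, and then in s, at n = k(M+1). This order produces
      -- the denominators (q;q)_{ℓm-ℓ} of the second series and the numerators with index km of the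
      -- first.
      D-diagonal : ∀ k ℓ M → D (k * M) (ℓ * M) ≡
        1ᵍ +ᵍ ∑ᵍ< M (λ m → ∑ᵍ< ℓ (λ i → F (k * suc m) (ℓ * suc m ∸ i)))
           +ᵍ ∑ᵍ< M (λ m → ∑ᵍ< k (λ j → G (k * suc m ∸ j ∸ 1) (ℓ * suc m ∸ ℓ)))
      D-diagonal k ℓ zero    = begin
        D (k * 0) (ℓ * 0)  ≡⟨ cong₂ D (ℕ.*-zeroʳ k) (ℕ.*-zeroʳ ℓ) ⟩
        F 0 0              ≡⟨ F-zero 0 ⟩
        1ᵍ                 ≡⟨ ℚᵢ.+-identityʳ 1ᵍ ⟨
        1ᵍ +ᵍ 0ᵍ           ≡⟨ ℚᵢ.+-identityʳ (1ᵍ +ᵍ 0ᵍ) ⟨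
        1ᵍ +ᵍ 0ᵍ +ᵍ 0ᵍ     ∎
        where open ≡-Reasoning
      D-diagonal k ℓ (suc M) = begin
        D (k * suc M) (ℓ * suc M)
          ≡⟨ cong (D (k * suc M)) ℓ[1+M] ⟩
        D (k * suc M) (ℓ * M + ℓ)
          ≡⟨ D-vertical (k * suc M) (ℓ * M) ℓ ⟩
        D (k * suc M) (ℓ * M) +ᵍ ∑ᵍ< ℓ (λ i → F (k * suc M) (ℓ * M + ℓ ∸ i))
          ≡⟨ cong₂ _+ᵍ_ (cong (λ n → D n (ℓ * M)) k[1+M])
               (cong (λ s → ∑ᵍ< ℓ (λ i → F (k * suc M) (s ∸ i))) (sym ℓ[1+M])) ⟩
        D (k * M + k) (ℓ * M) +ᵍ V M
          ≡⟨ cong (_+ᵍ V M) (D-horizontal (k * M) (ℓ * M) k) ⟩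
        D (k * M) (ℓ * M) +ᵍ ∑ᵍ< k (λ j → G (k * M + k ∸ j ∸ 1) (ℓ * M)) +ᵍ V M
          ≡⟨ cong₂ (λ n s → D (k * M) (ℓ * M) +ᵍ ∑ᵍ< k (λ j → G (n ∸ j ∸ 1) s) +ᵍ V M)
               (sym k[1+M]) (sym (trans (cong (_∸ ℓ) ℓ[1+M]) (ℕ.m+n∸n≡m (ℓ * M) ℓ))) ⟩
        D (k * M) (ℓ * M) +ᵍ H M +ᵍ V M
          ≡⟨ cong (λ d → d +ᵍ H M +ᵍ V M) (D-diagonal k ℓ M) ⟩
        1ᵍ +ᵍ ∑ᵍ< M V +ᵍ ∑ᵍ< M H +ᵍ H M +ᵍ V M
          ≡⟨ solveᵍ 5 (λ e v h x y → e ⊕ v ⊕ h ⊕ x ⊕ y ⊜ e ⊕ (v ⊕ y) ⊕ (h ⊕ x)) refl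
               1ᵍ (∑ᵍ< M V) (∑ᵍ< M H) (H M) (V M) ⟩
        1ᵍ +ᵍ (∑ᵍ< M V +ᵍ V M) +ᵍ (∑ᵍ< M H +ᵍ H M)
          ≡⟨ cong₂ (λ v h → 1ᵍ +ᵍ v +ᵍ h) (∑ᵍ<-suc M V) (∑ᵍ<-suc M H) ⟨
        1ᵍ +ᵍ ∑ᵍ< (suc M) V +ᵍ ∑ᵍ< (suc M) H ∎
        where
        open ≡-Reasoning
        V H : ℕ → ℚ[i]
        V m = ∑ᵍ< ℓ (λ i → F (k * suc m) (ℓ * suc m ∸ i))
        H m = ∑ᵍ< k (λ j → G (k * suc m ∸ j ∸ 1) (ℓ * suc m ∸ ℓ))
        ℓ[1+M] : ℓ * suc M ≡ ℓ * M + ℓ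
        ℓ[1+M] = trans (ℕ.*-suc ℓ M) (ℕ.+-comm ℓ (ℓ * M))
        k[1+M] : k * suc M ≡ k * M + k
        k[1+M] = trans (ℕ.*-suc k M) (ℕ.+-comm k (k * M))

-- Estimates uniform in q and z

-- With r < 1 and c = 1 / (1 - r), the terms are at most
-- ∏ (1 + K r^(i+1)) · c^s · K^s · r^(sn + s(s+1)/2), which splits into a factor in n
-- and a factor in s whose successive ratios tend to r and 0, both below θ.
module Estimates {r K : ℚ} (0≤r : 0ℚ ≤ᑫ r) (r<1 : r <ᑫ 1ℚ) (0≤K : 0ℚ ≤ᑫ K) where

  -- `θ` is the midpoint of r and 1: above the limiting ratio r, yet still summable, with `σ` the
  -- sum of its powers.
  θ σ c : ℚ
  θ = ½ *ᑫ (1ℚ +ᑫ r)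
  σ = recip (1ℚ -ᑫ θ)
  c = recip (1ℚ -ᑫ r)

  pochBound : ℕ → ℚ
  pochBound zero    = 1ℚ
  pochBound (suc n) = pochBound n *ᑫ (1ℚ +ᑫ K *ᑫ r *ᑫ r ^ᑫ n)

  nFactor sFactor : ℕ → ℚ
  nFactor n = pochBound n *ᑫ r ^ᑫ n
  sFactor s = c ^ᑫ s *ᑫ K ^ᑫ s *ᑫ r ^ᑫ triangular s

  abstract

    private

      r≤1 : r ≤ᑫ 1ℚ
      r≤1 = ℚ.<⇒≤ r<1

    θ<1 : θ <ᑫ 1ℚ
    θ<1 = subst (θ <ᑫ_) (solve 0 (con ½ :* (con 1ℚ :+ con 1ℚ) := con 1ℚ) refl)
      (ℚ.*-monoʳ-<-pos ½ (ℚ.+-monoʳ-< 1ℚ r<1))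

    r<θ : r <ᑫ θ
    r<θ = subst (_<ᑫ θ) (solve 1 (λ r → con ½ :* (r :+ r) := r) refl r)
      (ℚ.*-monoʳ-<-pos ½ (ℚ.+-monoˡ-< r r<1))

    0<θ : 0ℚ <ᑫ θ
    0<θ = ℚ.≤-<-trans 0≤r r<θ

    0≤θ : 0ℚ ≤ᑫ θ
    0≤θ = ℚ.<⇒≤ 0<θ

    0≤σ : 0ℚ ≤ᑫ σ
    0≤σ = ℚ.<⇒≤ (recip-pos (0<1- θ<1))

    1+θσ≡σ : 1ℚ +ᑫ θ *ᑫ σ ≡ σ
    1+θσ≡σ = trans (cong (_+ᑫ θ *ᑫ σ) (sym (*-recip (0<1- θ<1))))
      (solve 2 (λ t s → (con 1ℚ :- t) :* s :+ t :* s := s) refl θ σ)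

    0≤c : 0ℚ ≤ᑫ c
    0≤c = ℚ.<⇒≤ (recip-pos (0<1- r<1))

    0≤pochBound : ∀ n → 0ℚ ≤ᑫ pochBound n
    0≤pochBound zero    = ℚ.<⇒≤ 0<1
    0≤pochBound (suc n) = *-nonNeg (0≤pochBound n)
      (+-nonNeg (ℚ.<⇒≤ 0<1) (*-nonNeg (*-nonNeg 0≤K 0≤r) (^ᑫ-nonNeg 0≤r n)))

    0≤nFactor : ∀ n → 0ℚ ≤ᑫ nFactor n
    0≤nFactor n = *-nonNeg (0≤pochBound n) (^ᑫ-nonNeg 0≤r n)

    0≤sFactor : ∀ s → 0ℚ ≤ᑫ sFactor s
    0≤sFactor s = *-nonNeg (*-nonNeg (^ᑫ-nonNeg 0≤c s) (^ᑫ-nonNeg 0≤K s))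
      (^ᑫ-nonNeg 0≤r (triangular s))

    nFactor-decay : ∃ λ C → 0ℚ ≤ᑫ C × ∀ n → nFactor n ≤ᑫ C *ᑫ θ ^ᑫ n
    nFactor-decay =
      -- The ratio of successive factors is r + K r² r^n, and its excess over r eventually fits into
      -- θ - r.
      let N , ≤gap = scaled-^ᑫ→0 0≤r r<1 (*-nonNeg (*-nonNeg 0≤K 0≤r) 0≤r) 0<θ-r
      in eventual-ratio⇒geometric 0<θ N nFactor 0≤nFactor λ n N≤n → subst₂ _≤ᑫ_
        (solve 4 (λ p K r x → (r :+ K :* r :* r :* x) :* (p :* x) :=
          p :* (con 1ℚ :+ K :* r :* x) :* (r :* x)) refl (pochBound n) K r (r ^ᑫ n))
        refl
        (ℚ.*-monoʳ-≤-nonNeg (nFactor n) {{ℚ.nonNegative (0≤nFactor n)}}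
          (subst (r +ᑫ K *ᑫ r *ᑫ r *ᑫ r ^ᑫ n ≤ᑫ_)
            (solve 2 (λ r t → r :+ (t :- r) := t) refl r θ)
            (ℚ.+-monoʳ-≤ r (≤gap N≤n))))
      where
      0<θ-r : 0ℚ <ᑫ θ -ᑫ r
      0<θ-r = subst (_<ᑫ θ -ᑫ r) (ℚ.+-inverseʳ r) (ℚ.+-monoˡ-< (-ᑫ r) r<θ)

    sFactor-decay : ∃ λ C → 0ℚ ≤ᑫ C × ∀ s → sFactor s ≤ᑫ C *ᑫ θ ^ᑫ s
    sFactor-decay =
      -- The ratio of successive factors is c K r r^s: the quadratic exponent of r overcomes the
      -- growth of c^s K^s.
      let N , ≤θ = scaled-^ᑫ→0 0≤r r<1 (*-nonNeg (*-nonNeg 0≤c 0≤K) 0≤r) 0<θ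
      in eventual-ratio⇒geometric 0<θ N sFactor 0≤sFactor λ s N≤s → subst₂ _≤ᑫ_
        (trans
          (solve 7 (λ c K r x y z w → (c :* K :* r :* w) :* (x :* y :* z) :=
            (c :* x) :* (K :* y) :* ((r :* w) :* z))
            refl c K r (c ^ᑫ s) (K ^ᑫ s) (r ^ᑫ triangular s) (r ^ᑫ s))
          (cong (c ^ᑫ suc s *ᑫ K ^ᑫ suc s *ᑫ_) (sym (^ᑫ.^-homo-* r (suc s) (triangular s)))))
        refl
        (ℚ.*-monoʳ-≤-nonNeg (sFactor s) {{ℚ.nonNegative (0≤sFactor s)}} (≤θ N≤s))

  -- `C` suffices for `F`; the additional power of z in `G` costs a factor `K`, and `1 + K` serves
  -- both.
  C A : ℚ
  C = proj₁ nFactor-decay *ᑫ proj₁ sFactor-decay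
  A = (1ℚ +ᑫ K) *ᑫ C

  abstract

    private

      0≤C : 0ℚ ≤ᑫ C
      0≤C = *-nonNeg (proj₁ (proj₂ nFactor-decay)) (proj₁ (proj₂ sFactor-decay))

      factors-≤ : ∀ n s → nFactor n *ᑫ sFactor s ≤ᑫ C *ᑫ θ ^ᑫ (n + s)
      factors-≤ n s = subst (nFactor n *ᑫ sFactor s ≤ᑫ_)
        (trans (solve 4 (λ a b x y → (a :* x) :* (b :* y) := (a :* b) :* (x :* y)) refl
            (proj₁ nFactor-decay) (proj₁ sFactor-decay) (θ ^ᑫ n) (θ ^ᑫ s))
          (cong (C *ᑫ_) (sym (^ᑫ.^-homo-* θ n s))))
        (*-mono (0≤nFactor n)
          (*-nonNeg (proj₁ (proj₂ sFactor-decay)) (^ᑫ-nonNeg 0≤θ s))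
          (proj₂ (proj₂ nFactor-decay) n) (proj₂ (proj₂ sFactor-decay) s))

    0≤A : 0ℚ ≤ᑫ A
    0≤A = *-nonNeg (+-nonNeg (ℚ.<⇒≤ 0<1) 0≤K) 0≤C

    A-^-≤ : ∀ {m n} → m ℕ.≤ n → A *ᑫ θ ^ᑫ n ≤ᑫ A *ᑫ θ ^ᑫ m
    A-^-≤ m≤n = ℚ.*-monoˡ-≤-nonNeg A {{ℚ.nonNegative 0≤A}} (^ᑫ-antimono 0≤θ (ℚ.<⇒≤ θ<1) m≤n)

    A-^-+ : ∀ m n → A *ᑫ θ ^ᑫ (m + n) ≡ A *ᑫ θ ^ᑫ m *ᑫ θ ^ᑫ n
    A-^-+ m n = trans (cong (A *ᑫ_) (^ᑫ.^-homo-* θ m n)) (sym (ℚ.*-assoc A (θ ^ᑫ m) (θ ^ᑫ n)))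

  module _ {q z : ℚ[i]} (q≼r : q ≼ r) (z≼K : z ≼ K) where

    open Path q z

    abstract

      private

        1-q^-≽ : ∀ s → (1ℚ -ᑫ r) *ᑫ (1ℚ -ᑫ r) ≤ᑫ normSqᵍ (1ᵍ -ᵍ q ^ᵍ suc s)
        1-q^-≽ s = 1-≽ (≼-weaken (^ᵍ-≼ q≼r (suc s))
          (*-nonExpansiveʳ 0≤r (^ᑫ-≤1 0≤r r≤1 s))) r≤1

      units : ∀ s → (1ᵍ -ᵍ q ^ᵍ suc s) *ᵍ invᵍ (1ᵍ -ᵍ q ^ᵍ suc s) ≡ 1ᵍ
      units s = *ᵍ-inverseʳ (1ᵍ -ᵍ q ^ᵍ suc s)
        (ℚ.<-≤-trans (*-pos (0<1- r<1) (0<1- r<1)) (1-q^-≽ s))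

      1/[q]-≼ : ∀ s → 1/[q] s ≼ c ^ᑫ s
      1/[q]-≼ zero    = 1ᵍ-≼
      1/[q]-≼ (suc s) = subst (1/[q] (suc s) ≼_) (ℚ.*-comm (c ^ᑫ s) c)
        (*ᵍ-≼ (1/[q]-≼ s) (invᵍ-≼ {1ᵍ -ᵍ q ^ᵍ suc s} (0<1- r<1) (*-recip (0<1- r<1)) 0≤c (1-q^-≽ s)))

      poch-≼ : ∀ n → poch (-ᵍ z *ᵍ q) n ≼ pochBound n
      poch-≼ zero    = 1ᵍ-≼
      poch-≼ (suc n) = *ᵍ-≼ (poch-≼ n)
        (+ᵍ-≼ 1ᵍ-≼ (-ᵍ-≼ (*ᵍ-≼ (*ᵍ-≼ (-ᵍ-≼ z≼K) q≼r) (^ᵍ-≼ q≼r n))))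

      private

        -- Only the part n + s(s+1)/2 of the exponent of q is used, so that the bound separates into
        -- `nFactor` and `sFactor`.
        term-≼ : ∀ n s t e → n + triangular s ℕ.≤ e →
                 poch (-ᵍ z *ᵍ q) n *ᵍ 1/[q] s *ᵍ z ^ᵍ t *ᵍ q ^ᵍ e ≼
                 pochBound n *ᑫ c ^ᑫ s *ᑫ K ^ᑫ t *ᑫ (r ^ᑫ n *ᑫ r ^ᑫ triangular s)
        term-≼ n s t e ≤e = ≼-weaken
          (*ᵍ-≼ (*ᵍ-≼ (*ᵍ-≼ (poch-≼ n) (1/[q]-≼ s)) (^ᵍ-≼ z≼K t)) (^ᵍ-≼ q≼r e))
          (ℚ.*-monoˡ-≤-nonNeg (pochBound n *ᑫ c ^ᑫ s *ᑫ K ^ᑫ t)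
            {{ℚ.nonNegative (*-nonNeg (*-nonNeg (0≤pochBound n) (^ᑫ-nonNeg 0≤c s)) (^ᑫ-nonNeg 0≤K t))}}
            (subst (r ^ᑫ e ≤ᑫ_) (^ᑫ.^-homo-* r n (triangular s)) (^ᑫ-antimono 0≤r r≤1 ≤e)))

      -- Positive s makes the exponent sn at least n; `F n 0` is the finite product itself and has
      -- no such factor.
      F-≼ : ∀ n s → 0 ℕ.< s → F n s ≼ A *ᑫ θ ^ᑫ (n + s)
      F-≼ n s@(suc s′) _ = ≼-weaken
        (term-≼ n s s (s * n + triangular s) (ℕ.+-monoˡ-≤ (triangular s) (ℕ.m≤m+n n (s′ * n))))
        (ℚ.≤-trans
          (subst (_≤ᑫ C *ᑫ θ ^ᑫ (n + s))
            (solve 5 (λ p x y u v → (p :* u) :* (x :* y :* v) := p :* x :* y :* (u :* v)) refl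
              (pochBound n) (c ^ᑫ s) (K ^ᑫ s) (r ^ᑫ n) (r ^ᑫ triangular s))
            (factors-≤ n s))
          (ℚ.*-monoʳ-≤-nonNeg (θ ^ᑫ (n + s)) {{ℚ.nonNegative (^ᑫ-nonNeg 0≤θ (n + s))}}
            (subst₂ _≤ᑫ_ refl (solve 2 (λ K C → C :+ K :* C := (con 1ℚ :+ K) :* C) refl K C)
              (≤-+-nonNeg {C} (*-nonNeg 0≤K 0≤C)))))

      G-≼ : ∀ n s → G n s ≼ A *ᑫ θ ^ᑫ (n + s)
      G-≼ n s = ≼-weaken
        (term-≼ n s (suc s) (suc s * suc n + triangular s)
          (ℕ.+-monoˡ-≤ (triangular s) (ℕ.≤-trans (ℕ.n≤1+n n) (ℕ.m≤m+n (suc n) (s * suc n)))))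
        (ℚ.≤-trans
          (subst (_≤ᑫ K *ᑫ (C *ᑫ θ ^ᑫ (n + s)))
            (solve 6 (λ p x y u v K → K :* ((p :* u) :* (x :* y :* v)) :=
                                      p :* x :* (K :* y) :* (u :* v)) refl
              (pochBound n) (c ^ᑫ s) (K ^ᑫ s) (r ^ᑫ n) (r ^ᑫ triangular s) K)
            (ℚ.*-monoˡ-≤-nonNeg K {{ℚ.nonNegative 0≤K}} (factors-≤ n s)))
          (subst₂ _≤ᑫ_ (ℚ.*-assoc K C (θ ^ᑫ (n + s))) refl
            (ℚ.*-monoʳ-≤-nonNeg (θ ^ᑫ (n + s)) {{ℚ.nonNegative (^ᑫ-nonNeg 0≤θ (n + s))}}
              (subst₂ _≤ᑫ_ refl (solve 2 (λ K C → K :* C :+ C := (con 1ℚ :+ K) :* C) refl K C)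
                (≤-+-nonNeg {K *ᑫ C} 0≤C)))))

      -- From (N, 0) the path runs along the axis to (n, 0) and then up to (n, s). Each of the two
      -- legs is dominated by a geometric series starting at `A θ^N`.
      D-tail : ∀ N n s → N ℕ.≤ n → D n s -ᵍ poch (-ᵍ z *ᵍ q) N ≼ (A *ᑫ σ +ᑫ A *ᑫ σ) *ᑫ θ ^ᑫ N
      D-tail N n s N≤n = subst₂ _≼_
        (trans
          (solveᵍ 3 (λ p x y → x ⊕ y ⊜ p ⊕ x ⊕ y ⊖ p) refl (poch (-ᵍ z *ᵍ q) N) horizontal vertical)
          (cong (_-ᵍ poch (-ᵍ z *ᵍ q) N) (sym D≡)))
        (solve 3 (λ A x s → A :* x :* s :+ A :* x :* s := (A :* s :+ A :* s) :* x)
          refl A (θ ^ᑫ N) σ)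
        (+ᵍ-≼
          (∑ᵍ<-geometric-≼ 0≤θ 0≤σ 1+θσ≡σ (n ∸ N) 0≤Aθ^N λ j →
            subst (G (N + j) 0 ≼_)
              (trans (cong (λ m → A *ᑫ θ ^ᑫ m) (ℕ.+-identityʳ (N + j))) (A-^-+ N j))
              (G-≼ (N + j) 0))
          (∑ᵍ<-geometric-≼ 0≤θ 0≤σ 1+θσ≡σ s 0≤Aθ^N λ t → ≼-weaken (F-≼ n (suc t) ℕ.z<s)
            (subst (A *ᑫ θ ^ᑫ (n + suc t) ≤ᑫ_) (A-^-+ N t)
              (A-^-≤ (ℕ.+-mono-≤ N≤n (ℕ.n≤1+n t))))))
        where
        horizontal vertical : ℚ[i]
        horizontal = ∑ᵍ< (n ∸ N) (λ j → G (N + j) 0)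
        vertical = ∑ᵍ< s (λ t → F n (suc t))
        0≤Aθ^N : 0ℚ ≤ᑫ A *ᑫ θ ^ᑫ N
        0≤Aθ^N = *-nonNeg 0≤A (^ᑫ-nonNeg 0≤θ N)
        D-row : ∀ n s → D n s ≡ D n 0 +ᵍ ∑ᵍ< s (λ t → F n (suc t))
        D-row n zero    = sym (ℚᵢ.+-identityʳ (D n 0))
        D-row n (suc s) = trans (cong (_+ᵍ F n (suc s)) (D-row n s))
          (trans (ℚᵢ.+-assoc (D n 0) (∑ᵍ< s (λ t → F n (suc t))) (F n (suc s)))
            (cong (D n 0 +ᵍ_) (sym (∑ᵍ<-suc s (λ t → F n (suc t))))))
        D-column : ∀ b → D (N + b) 0 ≡ D N 0 +ᵍ ∑ᵍ< b (λ j → G (N + j) 0)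
        D-column zero    =
          trans (cong (λ n → D n 0) (ℕ.+-identityʳ N)) (sym (ℚᵢ.+-identityʳ (D N 0)))
        D-column (suc b) = trans (cong (λ n → D n 0) (ℕ.+-suc N b))
          (trans (D-step units (N + b) 0) (trans (cong (_+ᵍ G (N + b) 0) (D-column b))
            (trans (ℚᵢ.+-assoc (D N 0) (∑ᵍ< b (λ j → G (N + j) 0)) (G (N + b) 0))
              (cong (D N 0 +ᵍ_) (sym (∑ᵍ<-suc b (λ j → G (N + j) 0)))))))
        D≡ : D n s ≡ poch (-ᵍ z *ᵍ q) N +ᵍ horizontal +ᵍ vertical
        D≡ = trans (D-row n s) (cong (_+ᵍ vertical)
          (trans (cong (λ n → D n 0) (sym (ℕ.m+[n∸m]≡n N≤n)))
            (trans (D-column (n ∸ N)) (cong (_+ᵍ horizontal) (F-zero N)))))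

      -- All ℓ terms share n = k(m+1) ≥ m, which supplies θ^m; i < ℓ keeps s positive.
      vertical-≼ : ∀ k ℓ → .{{NonZero k}} → ∀ m →
        ∑ᵍ< ℓ (λ i → F (k * suc m) (ℓ * suc m ∸ i)) ≼ ∑ᑫ< ℓ A *ᑫ θ ^ᑫ m
      vertical-≼ k ℓ m = ∑ᵍ<-≼ ℓ (^ᑫ-nonNeg 0≤θ m) λ i i<ℓ → ≼-weaken
        (F-≼ (k * suc m) (ℓ * suc m ∸ i)
          (ℕ.m<n⇒0<n∸m (ℕ.<-≤-trans i<ℓ (ℕ.m≤m*n ℓ (suc m)))))
        (A-^-≤ (ℕ.≤-trans (ℕ.≤-trans (ℕ.n≤1+n m) (ℕ.m≤n*m (suc m) k))
          (ℕ.m≤m+n (k * suc m) (ℓ * suc m ∸ i))))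

      -- Here the decay comes from the constant height s = ℓm ≥ m.
      horizontal-≼ : ∀ k ℓ → .{{NonZero ℓ}} → ∀ m →
        ∑ᵍ< k (λ j → G (k * suc m ∸ j ∸ 1) (ℓ * suc m ∸ ℓ)) ≼ ∑ᑫ< k A *ᑫ θ ^ᑫ m
      horizontal-≼ k ℓ m = ∑ᵍ<-≼ k (^ᑫ-nonNeg 0≤θ m) λ j j<k → ≼-weaken
        (G-≼ (k * suc m ∸ j ∸ 1) (ℓ * suc m ∸ ℓ))
        (A-^-≤ (ℕ.≤-trans (subst (m ℕ.≤_)
            (sym (trans (cong (_∸ ℓ) (ℕ.*-suc ℓ m)) (ℕ.m+n∸m≡n ℓ (ℓ * m))))
            (ℕ.m≤n*m m ℓ))
          (ℕ.m≤n+m (ℓ * suc m ∸ ℓ) (k * suc m ∸ j ∸ 1))))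

-- Evaluation of the terms of the two series

abstract

  ev-product : ∀ {n} (f : Fin n → ℂ) N → ev (product f) N ≡ productᵍ (λ i → ev (f i) N)
  ev-product {zero}  f N = refl
  ev-product {suc n} f N = cong (ev (f Fin.zero) N *ᵍ_) (ev-product (f ∘ Fin.suc) N)

  productᵍ-cong : ∀ {n} {f g : Fin n → ℚ[i]} → (∀ i → f i ≡ g i) → productᵍ f ≡ productᵍ g
  productᵍ-cong {zero}  f≗g = refl
  productᵍ-cong {suc n} f≗g = cong₂ _*ᵍ_ (f≗g Fin.zero) (productᵍ-cong (f≗g ∘ Fin.suc))

  productᵍ-poch : ∀ q z a n → productᵍ {n} (λ i → 1ᵍ -ᵍ a *ᵍ q ^ᵍ toℕ i) ≡ Path.poch q z a n
  productᵍ-poch q z a zero    = refl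
  productᵍ-poch q z a (suc n) = trans
    (cong ((1ᵍ -ᵍ a *ᵍ 1ᵍ) *ᵍ_) (trans
      (productᵍ-cong {n} (λ i → cong (λ x → 1ᵍ -ᵍ x) (sym (ℚᵢ.*-assoc a q (q ^ᵍ toℕ i)))))
      (productᵍ-poch q z (a *ᵍ q) n)))
    (sym (Path.poch-shift q z a n))

  ev-pochhammer : ∀ q z a n N →
    ev (pochhammer a q n) N ≡ Path.poch (ev q N) (ev z N) (ev a N) n
  ev-pochhammer q z a n N = trans (ev-product {n} (λ i → 1ᶜ -ᶜ a *ᶜ q ^ toℕ i) N)
    (trans (productᵍ-cong {n} (λ i → cong (λ x → 1ᵍ -ᵍ ev a N *ᵍ x) (ev-^ q (toℕ i) N)))
      (productᵍ-poch (ev q N) (ev z N) (ev a N) n))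

  triangular-*2 : ∀ s → triangular s * 2 ≡ s * suc s
  triangular-*2 zero    = refl
  triangular-*2 (suc s) = trans (ℕ.*-distribʳ-+ 2 (suc s) (triangular s))
    (trans (cong (suc s * 2 +_) (triangular-*2 s))
      (ℕ-solve 1 (λ s → (con′ 1 ⊞ s) ⊠ con′ 2 ⊞ s ⊠ (con′ 1 ⊞ s) ≐
                        (con′ 1 ⊞ s) ⊠ (con′ 2 ⊞ s)) refl s))

  -- With n = km and s = ℓm - i the numerator is s (2n + s + 1), twice sn + s(s+1)/2, so the
  -- division is exact.
  F-exponent : ∀ k ℓ m i → i ℕ.≤ ℓ * m →
    (ℓ * m ∸ i) * ((2 * k + ℓ) * m ∸ i + 1) / 2 ≡
    (ℓ * m ∸ i) * (k * m) + triangular (ℓ * m ∸ i)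
  F-exponent k ℓ m i i≤ℓm = trans (cong (_/ 2) (begin
    s * ((2 * k + ℓ) * m ∸ i + 1)
      ≡⟨ cong (λ e → s * (e ∸ i + 1)) (ℕ-solve 3 (λ k ℓ m →
           (con′ 2 ⊠ k ⊞ ℓ) ⊠ m ≐ con′ 2 ⊠ (k ⊠ m) ⊞ ℓ ⊠ m) refl k ℓ m) ⟩
    s * (2 * (k * m) + ℓ * m ∸ i + 1)
      ≡⟨ cong (λ e → s * (e + 1)) (ℕ.+-∸-assoc (2 * (k * m)) i≤ℓm) ⟩
    s * (2 * (k * m) + s + 1)
      ≡⟨ ℕ-solve 2 (λ n s → s ⊠ (con′ 2 ⊠ n ⊞ s ⊞ con′ 1) ≐
           s ⊠ n ⊠ con′ 2 ⊞ s ⊠ (con′ 1 ⊞ s)) refl (k * m) s ⟩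
    s * (k * m) * 2 + s * suc s
      ≡⟨ cong (s * (k * m) * 2 +_) (triangular-*2 s) ⟨
    s * (k * m) * 2 + triangular s * 2
      ≡⟨ ℕ.*-distribʳ-+ 2 (s * (k * m)) (triangular s) ⟨
    (s * (k * m) + triangular s) * 2 ∎)) (ℕ.m*n/n≡m (s * (k * m) + triangular s) 2)
    where
    open ≡-Reasoning
    s : ℕ
    s = ℓ * m ∸ i

  -- With s = ℓm and n = k(m+1) - j - 1 the numerator is (s+1)(2(n+1) + s). Writing k as j + 1 + d
  -- shows that no subtraction is truncated.
  G-exponent : ∀ k ℓ m j → j ℕ.< k →
    (ℓ * suc m ∸ ℓ + 1) * ((2 * k + ℓ) * suc m ∸ 2 * j ∸ ℓ) / 2 ≡
    suc (ℓ * suc m ∸ ℓ) * suc (k * suc m ∸ j ∸ 1) + triangular (ℓ * suc m ∸ ℓ)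
  G-exponent k ℓ m j j<k = trans (cong (_/ 2) (begin
    (s + 1) * ((2 * k + ℓ) * suc m ∸ 2 * j ∸ ℓ)
      ≡⟨ cong (λ e → (s + 1) * (e ∸ 2 * j ∸ ℓ)) split-product ⟩
    (s + 1) * (2 * j + (ℓ + (2 * suc (k * m + d) + ℓ * m)) ∸ 2 * j ∸ ℓ)
      ≡⟨ cong (λ e → (s + 1) * (e ∸ ℓ)) (ℕ.m+n∸m≡n (2 * j) _) ⟩
    (s + 1) * (ℓ + (2 * suc (k * m + d) + ℓ * m) ∸ ℓ)
      ≡⟨ cong ((s + 1) *_) (ℕ.m+n∸m≡n ℓ _) ⟩
    (s + 1) * (2 * suc (k * m + d) + ℓ * m)
      ≡⟨ cong₂ (λ n t → (s + 1) * (2 * suc n + t)) (sym n≡) (sym s≡) ⟩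
    (s + 1) * (2 * suc n + s)
      ≡⟨ ℕ-solve 2 (λ n s → (s ⊞ con′ 1) ⊠ (con′ 2 ⊠ (con′ 1 ⊞ n) ⊞ s) ≐
           (con′ 1 ⊞ s) ⊠ (con′ 1 ⊞ n) ⊠ con′ 2 ⊞ s ⊠ (con′ 1 ⊞ s)) refl n s ⟩
    suc s * suc n * 2 + s * suc s
      ≡⟨ cong (suc s * suc n * 2 +_) (triangular-*2 s) ⟨
    suc s * suc n * 2 + triangular s * 2
      ≡⟨ ℕ.*-distribʳ-+ 2 (suc s * suc n) (triangular s) ⟨
    (suc s * suc n + triangular s) * 2 ∎)) (ℕ.m*n/n≡m (suc s * suc n + triangular s) 2)
    where
    open ≡-Reasoning
    s n d : ℕ
    s = ℓ * suc m ∸ ℓ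
    n = k * suc m ∸ j ∸ 1
    d = k ∸ suc j
    k≡ : k ≡ suc j + d
    k≡ = sym (ℕ.m+[n∸m]≡n j<k)
    s≡ : s ≡ ℓ * m
    s≡ = trans (cong (_∸ ℓ) (ℕ.*-suc ℓ m)) (ℕ.m+n∸m≡n ℓ (ℓ * m))
    n≡ : n ≡ k * m + d
    n≡ = begin
      k * suc m ∸ j ∸ 1            ≡⟨ ℕ.∸-+-assoc (k * suc m) j 1 ⟩
      k * suc m ∸ (j + 1)          ≡⟨ cong₂ _∸_ (ℕ.*-suc k m) (ℕ.+-comm j 1) ⟩
      k + k * m ∸ suc j            ≡⟨ cong (λ x → x + k * m ∸ suc j) k≡ ⟩
      suc j + d + k * m ∸ suc j    ≡⟨ cong (_∸ suc j) (ℕ.+-assoc (suc j) d (k * m)) ⟩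
      suc j + (d + k * m) ∸ suc j  ≡⟨ ℕ.m+n∸m≡n (suc j) (d + k * m) ⟩
      d + k * m                    ≡⟨ ℕ.+-comm d (k * m) ⟩
      k * m + d                    ∎
    split-product : (2 * k + ℓ) * suc m ≡ 2 * j + (ℓ + (2 * suc (k * m + d) + ℓ * m))
    split-product = begin
      (2 * k + ℓ) * suc m
        ≡⟨ ℕ-solve 3 (λ k ℓ m → (con′ 2 ⊠ k ⊞ ℓ) ⊠ (con′ 1 ⊞ m) ≐
             con′ 2 ⊠ k ⊞ (ℓ ⊞ (con′ 2 ⊠ (k ⊠ m) ⊞ ℓ ⊠ m))) refl k ℓ m ⟩
      2 * k + (ℓ + (2 * (k * m) + ℓ * m))
        ≡⟨ cong (λ x → 2 * x + (ℓ + (2 * (k * m) + ℓ * m))) k≡ ⟩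
      2 * (suc j + d) + (ℓ + (2 * (k * m) + ℓ * m))
        ≡⟨ ℕ-solve 5 (λ j d ℓ x y →
             con′ 2 ⊠ (con′ 1 ⊞ j ⊞ d) ⊞ (ℓ ⊞ (con′ 2 ⊠ x ⊞ y)) ≐
             con′ 2 ⊠ j ⊞ (ℓ ⊞ (con′ 2 ⊠ (con′ 1 ⊞ (x ⊞ d)) ⊞ y))) refl j d ℓ (k * m) (ℓ * m) ⟩
      2 * j + (ℓ + (2 * suc (k * m + d) + ℓ * m)) ∎

  -- The threshold `N₀` is the same for all M and m, as the passage to the diagonal requires.
  ev-partial-sums-≼ : ∀ {θ σ B N₀} → 0ℚ ≤ᑫ θ → 0ℚ ≤ᑫ σ → 1ℚ +ᑫ θ *ᑫ σ ≡ σ → 0ℚ ≤ᑫ B →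
    (f : ℕ → ℂ) → (∀ n → N₀ ℕ.≤ n → ∀ m → ev (f m) n ≼ B *ᑫ θ ^ᑫ m) →
    ∀ M m n → N₀ ℕ.≤ n → M ℕ.≤ m →
    ev (∑< m f) n -ᵍ ev (∑< M f) n ≼ B *ᑫ σ *ᑫ θ ^ᑫ M
  ev-partial-sums-≼ {θ} {σ} {B} 0≤θ 0≤σ 1+θσ≡σ 0≤B f f≼ M m n N₀≤n M≤m = subst₂ _≼_
    (sym (begin
      ev (∑< m f) n -ᵍ ev (∑< M f) n
        ≡⟨ cong₂ _-ᵍ_ (ev-∑< m f n) (ev-∑< M f n) ⟩
      ∑ᵍ< m g -ᵍ ∑ᵍ< M g
        ≡⟨ cong (λ l → ∑ᵍ< l g -ᵍ ∑ᵍ< M g) (ℕ.m+[n∸m]≡n M≤m) ⟨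
      ∑ᵍ< (M + (m ∸ M)) g -ᵍ ∑ᵍ< M g
        ≡⟨ cong (_-ᵍ ∑ᵍ< M g) (∑ᵍ<-+ M (m ∸ M) g) ⟩
      ∑ᵍ< M g +ᵍ tail -ᵍ ∑ᵍ< M g
        ≡⟨ solveᵍ 2 (λ x y → x ⊕ y ⊖ x ⊜ y) refl (∑ᵍ< M g) tail ⟩
      tail ∎))
    (solve 3 (λ B x s → B :* x :* s := B :* s :* x) refl B (θ ^ᑫ M) σ)
    (∑ᵍ<-geometric-≼ 0≤θ 0≤σ 1+θσ≡σ (m ∸ M) (*-nonNeg 0≤B (^ᑫ-nonNeg 0≤θ M)) λ i →
      subst (g (M + i) ≼_)
        (trans (cong (B *ᑫ_) (^ᑫ.^-homo-* θ M i)) (sym (ℚ.*-assoc B (θ ^ᑫ M) (θ ^ᑫ i))))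
        (f≼ n N₀≤n (M + i)))
    where
    open ≡-Reasoning
    g : ℕ → ℚ[i]
    g i = ev (f i) n
    tail : ℚ[i]
    tail = ∑ᵍ< (m ∸ M) (λ i → g (M + i))

-- Convergence of the two series and of the infinite product

module _ (q z : ℂ) (∣q∣<1 : ∣ q ∣ <ʳ 1ʳ) (k ℓ : ℕ) .{{_ : NonZero k}} .{{_ : NonZero ℓ}} where

  S-summand T-summand : ℕ → ℕ → ℂ
  S-summand m i =
    (pochhammer (-ᶜ z *ᶜ q) q (k * m)
      ÷ᶜ pochhammer q q (ℓ * m ∸ i) [ pochhammer#0 ∣q∣<1 (ℓ * m ∸ i) ])
    *ᶜ z ^ (ℓ * m ∸ i)
    *ᶜ q ^ ((ℓ * m ∸ i) * ((2 * k + ℓ) * m ∸ i + 1) / 2)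
  T-summand m j =
    (pochhammer (-ᶜ z *ᶜ q) q (k * m ∸ j ∸ 1)
      ÷ᶜ pochhammer q q (ℓ * m ∸ ℓ) [ pochhammer#0 ∣q∣<1 (ℓ * m ∸ ℓ) ])
    *ᶜ z ^ (ℓ * m ∸ ℓ + 1)
    *ᶜ q ^ ((ℓ * m ∸ ℓ + 1) * ((2 * k + ℓ) * m ∸ 2 * j ∸ ℓ) / 2)

  S-term T-term : ℕ → ℂ
  S-term m = ∑< ℓ (S-summand m)
  T-term m = ∑< k (T-summand m)

  module Summation {r K : ℚ} (0≤r : 0ℚ ≤ᑫ r) (r<1 : r <ᑫ 1ℚ) (0≤K : 0ℚ ≤ᑫ K) (N₀ : ℕ)
    (q≼r : ∀ n → N₀ ℕ.≤ n → ev q n ≼ r) (z≼K : ∀ n → N₀ ℕ.≤ n → ev z n ≼ K) where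

    open Estimates 0≤r r<1 0≤K

    module _ (N : ℕ) (N₀≤N : N₀ ℕ.≤ N) where

      open Path (ev q N) (ev z N)

      private

        qᴺ≼r : ev q N ≼ r
        qᴺ≼r = q≼r N N₀≤N

        zᴺ≼K : ev z N ≼ K
        zᴺ≼K = z≼K N N₀≤N

      abstract

        ev-term : ∀ n s t e →
          ev ((pochhammer (-ᶜ z *ᶜ q) q n ÷ᶜ pochhammer q q s [ pochhammer#0 ∣q∣<1 s ])
              *ᶜ z ^ t *ᶜ q ^ e) N ≡
          poch (-ᵍ ev z N *ᵍ ev q N) n *ᵍ 1/[q] s *ᵍ ev z N ^ᵍ t *ᵍ ev q N ^ᵍ e
        ev-term n s t e = cong₂ _*ᵍ_
          (cong₂ _*ᵍ_
            (cong₂ _*ᵍ_ (ev-pochhammer q z (-ᶜ z *ᶜ q) n N)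
              -- Division evaluates to `invᵍ` of the whole denominator, which uniqueness of inverses
              -- turns into the product `1/[q] s`.
              (trans (cong invᵍ (ev-pochhammer q z q s N))
                (invᵍ-unique (poch (ev q N) s) (1/[q] s) (poch-*-1/[q] (units qᴺ≼r zᴺ≼K) s))))
            (ev-^ z t N))
          (ev-^ q e N)

        ev-S-term : ∀ m → ev (S-term (suc m)) N ≡
          ∑ᵍ< ℓ (λ i → F (k * suc m) (ℓ * suc m ∸ i))
        ev-S-term m = trans (ev-∑< ℓ (S-summand (suc m)) N) (∑ᵍ<-cong ℓ λ i i<ℓ → trans
          (ev-term (k * suc m) (ℓ * suc m ∸ i) (ℓ * suc m ∸ i)
            ((ℓ * suc m ∸ i) * ((2 * k + ℓ) * suc m ∸ i + 1) / 2))
          (cong (λ e → poch (-ᵍ ev z N *ᵍ ev q N) (k * suc m) *ᵍ 1/[q] (ℓ * suc m ∸ i) *ᵍ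
                       ev z N ^ᵍ (ℓ * suc m ∸ i) *ᵍ ev q N ^ᵍ e)
            (F-exponent k ℓ (suc m) i (ℕ.≤-trans (ℕ.<⇒≤ i<ℓ) (ℕ.m≤m*n ℓ (suc m))))))

        ev-T-term : ∀ m → ev (T-term (suc m)) N ≡
          ∑ᵍ< k (λ j → G (k * suc m ∸ j ∸ 1) (ℓ * suc m ∸ ℓ))
        ev-T-term m = trans (ev-∑< k (T-summand (suc m)) N) (∑ᵍ<-cong k λ j j<k → trans
          (ev-term (k * suc m ∸ j ∸ 1) (ℓ * suc m ∸ ℓ) (ℓ * suc m ∸ ℓ + 1)
            ((ℓ * suc m ∸ ℓ + 1) * ((2 * k + ℓ) * suc m ∸ 2 * j ∸ ℓ) / 2))
          (cong₂ (λ t e → poch (-ᵍ ev z N *ᵍ ev q N) (k * suc m ∸ j ∸ 1) *ᵍ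
                          1/[q] (ℓ * suc m ∸ ℓ) *ᵍ ev z N ^ᵍ t *ᵍ ev q N ^ᵍ e)
            (ℕ.+-comm (ℓ * suc m ∸ ℓ) 1)
            (G-exponent k ℓ m j j<k)))

        S-term-≼ : ∀ m → ev (S-term (suc m)) N ≼ ∑ᑫ< ℓ A *ᑫ θ ^ᑫ m
        S-term-≼ m = subst (_≼ _) (sym (ev-S-term m)) (vertical-≼ qᴺ≼r zᴺ≼K k ℓ m)

        T-term-≼ : ∀ m → ev (T-term (suc m)) N ≼ ∑ᑫ< k A *ᑫ θ ^ᑫ m
        T-term-≼ m = subst (_≼ _) (sym (ev-T-term m)) (horizontal-≼ qᴺ≼r zᴺ≼K k ℓ m)

        ev-partial-sum : ∀ M →
          1ᵍ +ᵍ ev (∑< M (S-term ∘ suc)) N +ᵍ ev (∑< M (T-term ∘ suc)) N ≡ D (k * M) (ℓ * M)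
        ev-partial-sum M = trans
          (cong₂ (λ x y → 1ᵍ +ᵍ x +ᵍ y)
            (trans (ev-∑< M (S-term ∘ suc) N) (∑ᵍ<-cong M (λ m _ → ev-S-term m)))
            (trans (ev-∑< M (T-term ∘ suc) N) (∑ᵍ<-cong M (λ m _ → ev-T-term m))))
          (sym (D-diagonal (units qᴺ≼r zᴺ≼K) k ℓ M))

        -- The sums of N terms at index N are exactly what the diagonal values of S and T hold
        -- there. With 1 they make up `D (k * N) (ℓ * N)`, so `D-tail` applies directly, as m ≤ N ≤
        -- kN.
        poch-tail-≼ : ∀ m → m ℕ.≤ N →
          ev (pochhammer (-ᶜ z *ᶜ q) q m) N -ᵍ
          (1ᵍ +ᵍ ev (∑< N (S-term ∘ suc)) N +ᵍ ev (∑< N (T-term ∘ suc)) N) ≼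
          (A *ᑫ σ +ᑫ A *ᑫ σ) *ᑫ θ ^ᑫ m
        poch-tail-≼ m m≤N = subst (_≼ _)
          (trans
            (solveᵍ 2 (λ d p → ⊝ (d ⊖ p) ⊜ p ⊖ d) refl
              (D (k * N) (ℓ * N)) (poch (-ᵍ ev z N *ᵍ ev q N) m))
            (cong₂ _-ᵍ_ (sym (ev-pochhammer q z (-ᶜ z *ᶜ q) m N)) (sym (ev-partial-sum N))))
          (-ᵍ-≼ (D-tail qᴺ≼r zᴺ≼K m (k * N) (ℓ * N) (ℕ.≤-trans m≤N (ℕ.m≤n*m N k))))

    module Sum (f : ℕ → ℂ) {B : ℚ} (0≤B : 0ℚ ≤ᑫ B)
               (f≼ : ∀ n → N₀ ℕ.≤ n → ∀ m → ev (f m) n ≼ B *ᑫ θ ^ᑫ m) where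

      close : ∀ M m n → N₀ ℕ.≤ n → M ℕ.≤ m →
              ev (∑< m f) n -ᵍ ev (∑< M f) n ≼ B *ᑫ σ *ᑫ θ ^ᑫ M
      close = ev-partial-sums-≼ 0≤θ 0≤σ 1+θσ≡σ 0≤B f f≼

      value : ℂ
      value = diagonal (λ M → ∑< M f) (*-nonNeg 0≤B 0≤σ) 0≤θ θ<1 N₀ close

      converges : (λ M → ∑< M f) ⟶ value
      converges = ⟶-diagonal (λ M → ∑< M f) (*-nonNeg 0≤B 0≤σ) 0≤θ θ<1 N₀ close

    module S = Sum (S-term ∘ suc) (∑ᑫ<-nonNeg ℓ 0≤A) S-term-≼
    module T = Sum (T-term ∘ suc) (∑ᑫ<-nonNeg k 0≤A) T-term-≼

    pochhammer-converges : Pochhammer∞ (-ᶜ z *ᶜ q) q (1ᶜ +ᶜ S.value +ᶜ T.value)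
    pochhammer-converges = ev⇒⟶ (pochhammer (-ᶜ z *ᶜ q) q) (1ᶜ +ᶜ S.value +ᶜ T.value) λ 0<ε →
      let M , θ^≤ = scaled-^ᑫ→0 0≤θ θ<1 (+-nonNeg (*-nonNeg 0≤A 0≤σ) (*-nonNeg 0≤A 0≤σ)) 0<ε
      in M , λ m M≤m → N₀ ℕ.⊔ m , λ n ≤n → ≼-weaken
        (poch-tail-≼ n (ℕ.m⊔n≤o⇒m≤o N₀ m ≤n) m (ℕ.m⊔n≤o⇒n≤o N₀ m ≤n))
        (θ^≤ M≤m)

  ∃-sums : ∃ λ P → ∃ λ S → ∃ λ T →
           Pochhammer∞ (-ᶜ z *ᶜ q) q P × HasSum₁ S-term S × HasSum₁ T-term T ×
           P ≈ᶜ 1ᶜ +ᶜ S +ᶜ T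
  ∃-sums =
    let r , 0≤r , r<1 , M , q≼r = ev-<1 q ∣q∣<1
        K , 0≤K , N , z≼K = ev-bounded z
        open Summation 0≤r r<1 0≤K (M ℕ.⊔ N)
          (λ n ≤n → q≼r n (ℕ.m⊔n≤o⇒m≤o M N ≤n)) (λ n ≤n → z≼K n (ℕ.m⊔n≤o⇒n≤o M N ≤n))
        P = 1ᶜ +ᶜ S.value +ᶜ T.value
    in P , S.value , T.value , pochhammer-converges , S.converges , T.converges
     , ≈ʳ-refl (re P) , ≈ʳ-refl (im P)
    where
    ≈ʳ-refl : ∀ x → x ≈ʳ x
    ≈ʳ-refl x 0<ε = 0 , λ {n} _ →
      subst (_<ᑫ _) (sym (cong ∣_∣ᑫ (ℚ.+-inverseʳ (seq x n)))) 0<ε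

theorem3p5 : (q z : ℂ) (∣q∣<1 : ∣ q ∣ <ʳ 1ʳ) (k ℓ : ℕ) → .{{_ : NonZero k}} → .{{_ : NonZero ℓ}} →
    ∃ λ (P : ℂ) → ∃ λ (S : ℂ) → ∃ λ (T : ℂ) →
    Pochhammer∞ (-ᶜ z *ᶜ q) q P
    × HasSum₁ (λ m → ∑< ℓ (λ i →
    (pochhammer (-ᶜ z *ᶜ q) q (k * m)
    ÷ᶜ pochhammer q q (ℓ * m ∸ i) [ pochhammer#0 ∣q∣<1 (ℓ * m ∸ i) ])
    *ᶜ z ^ (ℓ * m ∸ i)
    *ᶜ q ^ ((ℓ * m ∸ i) * ((2 * k + ℓ) * m ∸ i + 1) / 2))) S
    × HasSum₁ (λ m → ∑< k (λ j →
    (pochhammer (-ᶜ z *ᶜ q) q (k * m ∸ j ∸ 1)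
    ÷ᶜ pochhammer q q (ℓ * m ∸ ℓ) [ pochhammer#0 ∣q∣<1 (ℓ * m ∸ ℓ) ])
    *ᶜ z ^ (ℓ * m ∸ ℓ + 1)
    *ᶜ q ^ ((ℓ * m ∸ ℓ + 1) * ((2 * k + ℓ) * m ∸ 2 * j ∸ ℓ) / 2))) T
    × P ≈ᶜ 1ᶜ +ᶜ S +ᶜ T
theorem3p5 q z ∣q∣<1 k ℓ = ∃-sums q z ∣q∣<1 k ℓ
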